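{- Let $R$ be a Dedekind domain with field of fractions $K$, and let $\mathfrak{m}$ be a nonzero prime (hence maximal) ideal of $R$. Then the $\mathfrak{m}$-adic valuation $v_{\mathfrak{m}} : K \to \mathbb{Z}_{\mathrm{m}0}$ is discrete.
   Context: $\mathbb{Z}_{\mathrm{m}0}$ is the linearly ordered commutative group with zero obtained from the multiplicatively written ordered group $\mathbb{Z}$ (elements $\mathrm{of\_add}(n)$, $n\in\mathbb{Z}$, with $\mathrm{of\_add}(a+b)=\mathrm{of\_add}(a)\,\mathrm{of\_add}(b)$, ordered as $\mathbb{Z}$) by adjoining an absorbing smallest element $0$. A valuation on a commutative unitary ring $A$ is a function $v: A\to \mathbb{Z}_{\mathrm{m}0}$ with $v(0)=0$, $v(1)=1$, $v(xy)=v(x)v(y)$ and $v(x+y)\le\max\{v(x),v(y)\}$ for all $x,y$. It is called discrete if it is surjective onto $\mathbb{Z}_{\mathrm{m}0}$. The $\mathfrak{m}$-adic valuation $v_{\mathfrak{m}}: K\to\mathbb{Z}_{\mathrm{m}0}$ is defined by $v_{\mathfrak m}(0)=0$ and $v_{\mathfrak m}(r/s)=\mathrm{of\_add}(-(a(r)-a(s)))$ for nonzero $r,s\in R$, where $a(r)$ is the exponent of $\mathfrak{m}$ in the factorization of the principal ideal $(r)$ into maximal ideals. -}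

module Defs where

open import Level using (_⊔_; Lift; lift; lower) renaming (suc to lsuc)
open import Algebra.Bundles using (CommutativeRing; CommutativeSemiring)
open import Algebra.Morphism.Structures using (module RingMorphisms)
import Algebra.Construct.NaturalChoice.Max as Max
import Algebra.Properties.Ring as RingProperties
import Algebra.Properties.Semiring.Exp as Exp
import Algebra.Properties.Semiring.Sum as Sum
import Algebra.Solver.Ring.NaturalCoefficients.Default as SemiringSolver
open import Axiom.ExcludedMiddle using (ExcludedMiddle)
open import Data.Fin.Base as Fin using (Fin; toℕ)
open import Data.Integer.Base as ℤ using (ℤ; +_)
import Data.Integer.Properties as ℤ
open import Data.List.Base using (List; []; _∷_; _++_; foldr; filter; length)
open import Data.List.Relation.Unary.All as All using (All; []; _∷_)
import Data.List.Relation.Unary.All.Properties as All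
open import Data.Nat.Base as ℕ using (ℕ; zero; suc; _≤_)
import Data.Nat.Properties as ℕ
open import Data.Product.Base using (Σ; ∃; ∃₂; _×_; _,_; proj₁; proj₂)
open import Data.Sum.Base using (_⊎_; inj₁; inj₂)
open import Data.Vec.Functional as Vector using (Vector)
open import Function.Base using (_∘_)
open import Function.Definitions using (Surjective)
open import Induction.WellFounded using (Acc; acc; WellFounded)
open import Relation.Binary.Bundles using (TotalOrder)
import Relation.Binary.Construct.Add.Infimum.NonStrict as AddInfimum
open import Relation.Binary.PropositionalEquality.Core as ≡ using (_≡_)
open import Relation.Nullary.Construct.Add.Infimum using (_₋; ⊥₋)
  renaming ([_] to [_]₋)
open import Relation.Nullary.Decidable.Core using (Dec; yes; no; map′; decidable-stable)
open import Relation.Nullary.Negation.Core using (¬_; contradiction)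

-- ℤ written multiplicatively, with an absorbing least element adjoined.

ℤₘ₀ : Set
ℤₘ₀ = ℤ ₋

pattern 𝟎 = ⊥₋
pattern of-add n = [ n ]₋

𝟏 : ℤₘ₀
𝟏 = of-add (+ 0)

infixl 7 _·_

_·_ : ℤₘ₀ → ℤₘ₀ → ℤₘ₀
𝟎        · _        = 𝟎
of-add _ · 𝟎        = 𝟎
of-add a · of-add b = of-add (a ℤ.+ b)

ℤₘ₀-totalOrder : TotalOrder _ _ _
ℤₘ₀-totalOrder = record
  { isTotalOrder = AddInfimum.≤₋-isTotalOrder-≡ ℤ._≤_ ℤ.≤-isTotalOrder }

open TotalOrder ℤₘ₀-totalOrder public
  using () renaming (_≤_ to _≤ₘ₀_)

open Max ℤₘ₀-totalOrder public
  using () renaming (_⊔_ to max)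

module _ {a ℓ} (A : CommutativeRing a ℓ) where

  open CommutativeRing A

  record IsValuation (v : Carrier → ℤₘ₀) : Set (a ⊔ ℓ) where
    field
      cong     : ∀ {x y} → x ≈ y → v x ≡ v y
      0#-homo  : v 0# ≡ 𝟎
      1#-homo  : v 1# ≡ 𝟏
      *-homo   : ∀ x y → v (x * y) ≡ v x · v y
      +-ultra  : ∀ x y → v (x + y) ≤ₘ₀ max (v x) (v y)

  record IsDiscreteValuation (v : Carrier → ℤₘ₀) : Set (a ⊔ ℓ) where
    field
      isValuation : IsValuation v
      surjective  : Surjective _≈_ _≡_ v

record Ideal {c ℓ} (R : CommutativeRing c ℓ) : Set (lsuc (c ⊔ ℓ)) where
  open CommutativeRing R
  field
    Member   : Carrier → Set (c ⊔ ℓ)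
    resp     : ∀ {x y} → x ≈ y → Member x → Member y
    0#-mem   : Member 0#
    +-closed : ∀ {x y} → Member x → Member y → Member (x + y)
    *-closed : ∀ r {x} → Member x → Member (r * x)

module _ {c ℓ} {R : CommutativeRing c ℓ} where

  open CommutativeRing R
  open RingProperties ring
  open Sum semiring using (sum)

  infix 4 _∈_ _∉_ _⊆_ _≐_ _⊊_

  _∈_ _∉_ : Carrier → Ideal R → Set (c ⊔ ℓ)
  x ∈ I = Ideal.Member I x
  x ∉ I = ¬ (x ∈ I)

  _⊆_ _≐_ _⊊_ : Ideal R → Ideal R → Set (c ⊔ ℓ)
  I ⊆ J = ∀ {x} → x ∈ I → x ∈ J
  I ≐ J = (I ⊆ J) × (J ⊆ I)
  I ⊊ J = (I ⊆ J) × ∃ λ x → x ∈ J × x ∉ I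

  IsNonZero : Ideal R → Set (c ⊔ ℓ)
  IsNonZero I = ∃ λ x → x ∈ I × ¬ x ≈ 0#

  IsProper : Ideal R → Set (c ⊔ ℓ)
  IsProper I = 1# ∉ I

  record IsPrime (P : Ideal R) : Set (c ⊔ ℓ) where
    field
      proper : IsProper P
      prime  : ∀ {x y} → x * y ∈ P → x ∈ P ⊎ y ∈ P

  record IsMaximal (M : Ideal R) : Set (lsuc (c ⊔ ℓ)) where
    field
      proper  : IsProper M
      maximal : ∀ J → M ⊆ J → IsProper J → J ⊆ M

  IsFinitelyGenerated : Ideal R → Set (c ⊔ ℓ)
  IsFinitelyGenerated I = ∃ λ n → Σ (Vector Carrier n) λ g →
    (∀ i → g i ∈ I) ×
    (∀ {x} → x ∈ I → ∃ λ (a : Vector Carrier n) → x ≈ sum (λ i → a i * g i))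

  principal : Carrier → Ideal R
  principal r = record
    { Member   = λ x → ∃ λ a → x ≈ a * r
    ; resp     = λ x≈y (a , p) → a , trans (sym x≈y) p
    ; 0#-mem   = 0# , sym (zeroˡ r)
    ; +-closed = λ (a , p) (b , q) → a + b , trans (+-cong p q) (sym (distribʳ r a b))
    ; *-closed = λ s (a , p) → s * a , trans (*-congˡ p) (sym (*-assoc s a r))
    }

  unitIdeal : Ideal R
  unitIdeal = principal 1#

  infixr 7 _⊛_

  -- Finite sums of products x * y with x ∈ I and y ∈ J.
  data ProductMember (I J : Ideal R) : Carrier → Set (c ⊔ ℓ) where
    nil  : ∀ {z} → z ≈ 0# → ProductMember I J z
    cons : ∀ {x y w z} → x ∈ I → y ∈ J → ProductMember I J w →
           z ≈ x * y + w → ProductMember I J z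

  private
    P-resp : ∀ {I J x y} → x ≈ y → ProductMember I J x → ProductMember I J y
    P-resp e (nil p)          = nil (trans (sym e) p)
    P-resp e (cons xI yJ w p) = cons xI yJ w (trans (sym e) p)

    P-+ : ∀ {I J x y} → ProductMember I J x → ProductMember I J y →
          ProductMember I J (x + y)
    P-+ {y = y} (nil p) q = P-resp (sym (trans (+-congʳ p) (+-identityˡ y))) q
    P-+ {y = y} (cons xI yJ w p) q =
      cons xI yJ (P-+ w q) (trans (+-congʳ p) (+-assoc _ _ y))

    P-* : ∀ {I J} r {x} → ProductMember I J x → ProductMember I J (r * x)
    P-* r (nil p) = nil (trans (*-congˡ p) (zeroʳ r))
    P-* {I} r (cons xI yJ w p) = cons (Ideal.*-closed I r xI) yJ (P-* r w)
      (trans (*-congˡ p) (trans (distribˡ r _ _) (+-congʳ (sym (*-assoc r _ _)))))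

  _⊛_ : Ideal R → Ideal R → Ideal R
  I ⊛ J = record
    { Member   = ProductMember I J
    ; resp     = P-resp
    ; 0#-mem   = nil refl
    ; +-closed = P-+
    ; *-closed = P-*
    }

  ∏ : List (Ideal R) → Ideal R
  ∏ = foldr _⊛_ unitIdeal

  record MaximalFactorisation (I : Ideal R) : Set (lsuc (c ⊔ ℓ)) where
    field
      factors   : List (Ideal R)
      maximal   : All IsMaximal factors
      product-≐ : I ≐ ∏ factors

module _ {c ℓ} (R : CommutativeRing c ℓ) where

  open CommutativeRing R

  record IsDomain : Set (c ⊔ ℓ) where
    field
      1≉0           : ¬ 1# ≈ 0#
      noZeroDivisor : ∀ {x y} → x * y ≈ 0# → x ≈ 0# ⊎ y ≈ 0#

  record IsField : Set (c ⊔ ℓ) where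
    field
      1≉0     : ¬ 1# ≈ 0#
      inverse : ∀ {x} → ¬ x ≈ 0# → ∃ λ y → x * y ≈ 1#

  -- Read constructively, this together with 1# ≉ 0# implies excluded middle (see
  -- excludedMiddle below), so no separate classical axiom is needed.
  IsNoetherian : Set (lsuc (c ⊔ ℓ))
  IsNoetherian = (I : Ideal R) → IsFinitelyGenerated I

  HasDimension≤1 : Set (lsuc (c ⊔ ℓ))
  HasDimension≤1 = (P : Ideal R) → IsPrime P → IsNonZero P → IsMaximal P

record IsFractionField {c ℓ c′ ℓ′} (R : CommutativeRing c ℓ) (K : CommutativeRing c′ ℓ′)
  : Set (c ⊔ ℓ ⊔ c′ ⊔ ℓ′) where
  private
    module R = CommutativeRing R
    module K = CommutativeRing K
  open RingMorphisms R.rawRing K.rawRing using (IsRingMonomorphism)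
  field
    isField            : IsField K
    ι                  : R.Carrier → K.Carrier
    isRingMonomorphism : IsRingMonomorphism ι
    fraction           : ∀ x → ∃₂ λ r s → ¬ s R.≈ R.0# × x K.* ι s K.≈ ι r

module _ {c ℓ c′ ℓ′} {R : CommutativeRing c ℓ} {K : CommutativeRing c′ ℓ′}
         (F : IsFractionField R K) where

  private
    module R = CommutativeRing R
    module K = CommutativeRing K
  open IsFractionField F
  open Exp K.semiring using (_^_)
  open Sum K.semiring using (sum)

  IsIntegral : K.Carrier → Set (c ⊔ ℓ′)
  IsIntegral x = ∃ λ n → Σ (Vector R.Carrier n) λ a →
    x ^ n K.+ sum (λ i → ι (a i) K.* x ^ toℕ i) K.≈ K.0#

  IsIntegrallyClosed : Set (c ⊔ c′ ⊔ ℓ′)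
  IsIntegrallyClosed = ∀ x → IsIntegral x → ∃ λ r → ι r K.≈ x

  record IsDedekindDomain : Set (lsuc (c ⊔ ℓ) ⊔ c′ ⊔ ℓ′) where
    field
      isDomain           : IsDomain R
      isNoetherian       : IsNoetherian R
      isIntegrallyClosed : IsIntegrallyClosed
      dimension≤1        : HasDimension≤1 R

module Identities {c ℓ} (A : CommutativeSemiring c ℓ) where

  open CommutativeSemiring A
  open SemiringSolver A using (solve; _:+_; _:*_; _:=_)

  identity1 : ∀ i a j b x → (i + a * x) + (j + b * x) ≈ (i + j) + (a + b) * x
  identity1 = solve 5 (λ i a j b x → (i :+ a :* x) :+ (j :+ b :* x) := (i :+ j) :+ (a :+ b) :* x) refl

  identity2 : ∀ r i a x → r * (i + a * x) ≈ (r * i) + (r * a) * x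
  identity2 = solve 4 (λ r i a x → r :* (i :+ a :* x) := (r :* i) :+ (r :* a) :* x) refl

  identity3 : ∀ a b w y → (a * b + w) * y ≈ a * (b * y) + w * y
  identity3 = solve 4 (λ a b w y → (a :* b :+ w) :* y := a :* (b :* y) :+ w :* y) refl

  identity4 : ∀ t r x y → (t + r * x) * y ≈ y * t + r * (x * y)
  identity4 = solve 4 (λ t r x y → (t :+ r :* x) :* y := y :* t :+ r :* (x :* y)) refl

  identity5 : ∀ i a x j b y → (i + a * x) * (j + b * y) ≈ (j + b * y) * i + ((a * x) * j + (a * b) * (x * y))
  identity5 = solve 6 (λ i a x j b y → (i :+ a :* x) :* (j :+ b :* y) := (j :+ b :* y) :* i :+ ((a :* x) :* j :+ (a :* b) :* (x :* y))) refl

  identity6 : ∀ r u x → r * (u * x) ≈ u * (r * x)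
  identity6 = solve 3 (λ r u x → r :* (u :* x) := u :* (r :* x)) refl

  identity7 : ∀ b y z c → b * y + c * z ≈ y * b + z * c
  identity7 = solve 4 (λ b y z c → b :* y :+ c :* z := y :* b :+ z :* c) refl

  identity8 : ∀ x y z → x * (y * z) ≈ (y * x) * z
  identity8 = solve 3 (λ x y z → x :* (y :* z) := (y :* x) :* z) refl

  identity9 : ∀ p q z t → p * (q * (z * t)) ≈ (q * p * z) * t
  identity9 = solve 4 (λ p q z t → p :* (q :* (z :* t)) := (q :* p :* z) :* t) refl

  identity10 : ∀ a f t w b s →
    (a * (f * t) + w) + (b * f + s) * t ≈ (a + b) * (f * t) + (w + s * t)
  identity10 = solve 6 (λ a f t w b s →
    (a :* (f :* t) :+ w) :+ (b :* f :+ s) :* t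
      := (a :+ b) :* (f :* t) :+ (w :+ s :* t)) refl

  identity11 : ∀ a b c d → (a + b) + (c + d) ≈ (a + c) + (b + d)
  identity11 = solve 4 (λ a b c d →
    (a :+ b) :+ (c :+ d) := (a :+ c) :+ (b :+ d)) refl

module _ {c ℓ} {R : CommutativeRing c ℓ} where

  open CommutativeRing R
  private
    module Id = Identities commutativeSemiring

  -- I + (x)
  adjoin : Ideal R → Carrier → Ideal R
  adjoin I x = record
    { Member   = λ w → ∃₂ λ i a → i ∈ I × w ≈ i + a * x
    ; resp     = λ e (i , a , i∈ , p) → i , a , i∈ , trans (sym e) p
    ; 0#-mem   = 0# , 0# , Ideal.0#-mem I ,
        sym (trans (+-identityˡ _) (zeroˡ x))
    ; +-closed = λ (i , a , i∈ , p) (j , b , j∈ , q) →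
        i + j , a + b , Ideal.+-closed I i∈ j∈ ,
        trans (+-cong p q)
          (Id.identity1 i a j b x)
    ; *-closed = λ r (i , a , i∈ , p) → r * i , r * a , Ideal.*-closed I r i∈ ,
        trans (*-congˡ p)
          (Id.identity2 r i a x)
    }

  ⊆-adjoin : ∀ I x → I ⊆ adjoin I x
  ⊆-adjoin I x {i} i∈ = i , 0# , i∈ ,
    sym (trans (+-congˡ (zeroˡ x)) (+-identityʳ i))

  x∈adjoin : ∀ I x → x ∈ adjoin I x
  x∈adjoin I x = 0# , 1# , Ideal.0#-mem I ,
    sym (trans (+-identityˡ _) (*-identityˡ x))

  ⊊-adjoin : ∀ I x → x ∉ I → I ⊊ adjoin I x
  ⊊-adjoin I x x∉ = ⊆-adjoin I x , x , x∈adjoin I x , x∉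

  ⊛-mem : ∀ {I J : Ideal R} {x y} → x ∈ I → y ∈ J → x * y ∈ I ⊛ J
  ⊛-mem x∈ y∈ = cons x∈ y∈ (nil refl) (sym (+-identityʳ _))

  ⊛-⊆ : ∀ {I J : Ideal R} (L : Ideal R) → (∀ {x y} → x ∈ I → y ∈ J → x * y ∈ L) →
        I ⊛ J ⊆ L
  ⊛-⊆ L f (nil p)          = Ideal.resp L (sym p) (Ideal.0#-mem L)
  ⊛-⊆ L f (cons x∈ y∈ w p) =
    Ideal.resp L (sym p) (Ideal.+-closed L (f x∈ y∈) (⊛-⊆ L f w))

  *-closedʳ : ∀ (I : Ideal R) r {x} → x ∈ I → x * r ∈ I
  *-closedʳ I r {x} x∈ = Ideal.resp I (*-comm r x) (Ideal.*-closed I r x∈)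

  1∈⇒∈ : ∀ (I : Ideal R) → 1# ∈ I → ∀ {x} → x ∈ I
  1∈⇒∈ I 1∈ {x} = Ideal.resp I (*-identityʳ x) (Ideal.*-closed I x 1∈)

  ∈-unit : ∀ {x} → x ∈ unitIdeal {R = R}
  ∈-unit {x} = x , sym (*-identityʳ x)

  ∏-++ : ∀ (Is Js : List (Ideal R)) {x y} → x ∈ ∏ Is → y ∈ ∏ Js → x * y ∈ ∏ (Is ++ Js)
  ∏-++ []       Js x∈ y∈ = Ideal.*-closed (∏ Js) _ y∈
  ∏-++ (I ∷ Is) Js {y = y} (nil p) y∈ =
    nil (trans (*-congʳ p) (zeroˡ y))
  ∏-++ (I ∷ Is) Js {y = y} (cons {a} {b} {w} a∈ b∈ w∈ p) y∈ =
    cons a∈ (∏-++ Is Js b∈ y∈) (∏-++ (I ∷ Is) Js w∈ y∈)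
      (trans (*-congʳ p)
        (Id.identity3 a b w y))

module Factorisation {c ℓ c′ ℓ′} {R : CommutativeRing c ℓ} {K : CommutativeRing c′ ℓ′}
                     (F : IsFractionField R K) (D : IsDedekindDomain F) where

  open CommutativeRing R
  open RingProperties ring
  open Sum semiring using (sum; sum-cong-≋; ∑-distrib-+; *-distribˡ-sum)
  open IsDedekindDomain D
  open IsDomain isDomain
  private
    module Id = Identities commutativeSemiring

  -- The Noetherian hypothesis decides every P : a generator of the ideal
  -- { x | x ≈ 0# or P } is either zero or yields a proof of P, and if all
  -- of them are zero then P would give 1# ≈ 0#.

  excludedMiddle : ExcludedMiddle (c ⊔ ℓ)
  excludedMiddle {P} = decide (isNoetherian I)
    where
    I : Ideal R
    I = record
      { Member   = λ x → x ≈ 0# ⊎ P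
      ; resp     = λ { e (inj₁ p) → inj₁ (trans (sym e) p) ; e (inj₂ p) → inj₂ p }
      ; 0#-mem   = inj₁ refl
      ; +-closed = λ { (inj₁ p) (inj₁ q) → inj₁ (trans (+-cong p q) (+-identityˡ 0#))
                     ; (inj₁ p) (inj₂ q) → inj₂ q
                     ; (inj₂ p) _        → inj₂ p }
      ; *-closed = λ { r (inj₁ p) → inj₁ (trans (*-congˡ p) (zeroʳ r))
                     ; r (inj₂ p) → inj₂ p }
      }

    allZero? : ∀ {n} (g : Vector Carrier n) → (∀ i → g i ∈ I) →
               (∀ i → g i ≈ 0#) ⊎ P
    allZero? {zero}  g g∈ = inj₁ (λ ())
    allZero? {suc n} g g∈ with g∈ Fin.zero | allZero? (g ∘ Fin.suc) (g∈ ∘ Fin.suc)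
    ... | inj₂ p | _      = inj₂ p
    ... | inj₁ _ | inj₂ p = inj₂ p
    ... | inj₁ z | inj₁ f = inj₁ λ { Fin.zero → z ; (Fin.suc i) → f i }

    sum-zero : ∀ {n} (a g : Vector Carrier n) → (∀ i → g i ≈ 0#) →
               sum (λ i → a i * g i) ≈ 0#
    sum-zero {zero}  a g z = refl
    sum-zero {suc n} a g z = trans
      (+-cong (trans (*-congˡ (z Fin.zero)) (zeroʳ _))
              (sum-zero (a ∘ Fin.suc) (g ∘ Fin.suc) (z ∘ Fin.suc)))
      (+-identityˡ 0#)

    decide : IsFinitelyGenerated I → Dec P
    decide (n , g , g∈ , gen) with allZero? g g∈
    ... | inj₂ p = yes p
    ... | inj₁ z = no λ p → let a , q = gen {1#} (inj₂ p) in
                     1≉0 (trans q (sum-zero a g z))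

  _≈?_ : ∀ x y → Dec (x ≈ y)
  x ≈? y = map′ lower lift (excludedMiddle {Lift c (x ≈ y)})

  private
    stable : {P : Set (c ⊔ ℓ)} → ¬ ¬ P → P
    stable = decidable-stable excludedMiddle

    ¬⊆⇒∃ : ∀ {I J : Ideal R} → ¬ (I ⊆ J) → ∃ λ x → x ∈ I × x ∉ J
    ¬⊆⇒∃ I⊈J = stable λ ¬∃ → I⊈J λ {x} x∈I → stable λ x∉J → ¬∃ (x , x∈I , x∉J)

    *-cancelˡ : ∀ {b x y} → ¬ b ≈ 0# → b * x ≈ b * y → x ≈ y
    *-cancelˡ {b} {x} {y} b≉0 e with noZeroDivisor {b} {x - y}
      (trans (x[y-z]≈xy-xz b x y) (x≈y⇒x∙y⁻¹≈ε e))
    ... | inj₁ b≈0 = contradiction b≈0 b≉0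
    ... | inj₂ p   = x∙y⁻¹≈ε⇒x≈y x y p

  sum-∈ : ∀ (I : Ideal R) {n} (a g : Vector Carrier n) →
          (∀ i → g i ∈ I) → sum (λ i → a i * g i) ∈ I
  sum-∈ I {zero}  a g g∈ = Ideal.0#-mem I
  sum-∈ I {suc n} a g g∈ = Ideal.+-closed I
    (Ideal.*-closed I (a Fin.zero) (g∈ Fin.zero))
    (sum-∈ I (a ∘ Fin.suc) (g ∘ Fin.suc) (g∈ ∘ Fin.suc))

  -- Chain conditions are stated on families of generators because Ideal R
  -- is too large a type for Acc to be decided by excludedMiddle.
  Generators : Set c
  Generators = ∃ λ n → Vector Carrier n

  span : Generators → Ideal R
  span (n , g) = record
    { Member   = λ x → ∃ λ (a : Vector Carrier n) → x ≈ sum (λ i → a i * g i)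
    ; resp     = λ e (a , p) → a , trans (sym e) p
    ; 0#-mem   = (λ _ → 0#) ,
        sym (trans (sum-cong-≋ (λ i → trans (zeroˡ (g i)) (sym (zeroˡ 0#))))
            (trans (sym (*-distribˡ-sum {n} 0# (λ _ → 0#))) (zeroˡ _)))
    ; +-closed = λ (a , p) (b , q) → (λ i → a i + b i) ,
        trans (+-cong p q)
       (trans (sym (∑-distrib-+ (λ i → a i * g i) (λ i → b i * g i)))
              (sum-cong-≋ (λ i → sym (distribʳ (g i) (a i) (b i)))))
    ; *-closed = λ r (a , p) → (λ i → r * a i) ,
        trans (*-congˡ p)
       (trans (*-distribˡ-sum r (λ i → a i * g i))
              (sum-cong-≋ (λ i → sym (*-assoc r (a i) (g i)))))
    }

  span-⊆ : ∀ (I : Ideal R) {n} {g : Vector Carrier n} → (∀ i → g i ∈ I) →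
           span (n , g) ⊆ I
  span-⊆ I {g = g} g∈ (a , p) = Ideal.resp I (sym p) (sum-∈ I a g g∈)

  infix 4 _≻_

  _≻_ : Generators → Generators → Set (c ⊔ ℓ)
  H ≻ G = span G ⊊ span H

  private
    span-mono : (G : ℕ → Generators) → (∀ n → G (suc n) ≻ G n) →
                ∀ {m n} → m ℕ.≤′ n → span (G m) ⊆ span (G n)
    span-mono G inc (ℕ.≤′-reflexive ≡.refl)   p = p
    span-mono G inc {n = suc n} (ℕ.≤′-step le) p =
      proj₁ (inc n) (span-mono G inc le p)

    union : (G : ℕ → Generators) → (∀ n → G (suc n) ≻ G n) → Ideal R
    union G inc = record
      { Member   = λ x → ∃ λ n → x ∈ span (G n)
      ; resp     = λ e (n , p) → n , Ideal.resp (span (G n)) e p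
      ; 0#-mem   = 0 , Ideal.0#-mem (span (G 0))
      ; +-closed = λ (m , p) (n , q) → m ℕ.⊔ n ,
          Ideal.+-closed (span (G (m ℕ.⊔ n)))
            (span-mono G inc (ℕ.≤⇒≤′ (ℕ.m≤m⊔n m n)) p)
            (span-mono G inc (ℕ.≤⇒≤′ (ℕ.m≤n⊔m m n)) q)
      ; *-closed = λ r (n , p) → n , Ideal.*-closed (span (G n)) r p
      }

    bound : ∀ {n p} (Q : ℕ → Fin n → Set p) →
            (∀ {k l} i → k ≤ l → Q k i → Q l i) →
            (∀ i → ∃ λ k → Q k i) → ∃ λ k → ∀ i → Q k i
    bound {zero}  Q mono f = 0 , λ ()
    bound {suc n} Q mono f =
      let k , q = f Fin.zero
          l , r = bound (λ k i → Q k (Fin.suc i)) (mono ∘ Fin.suc) (f ∘ Fin.suc)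
      in k ℕ.⊔ l , λ { Fin.zero    → mono Fin.zero (ℕ.m≤m⊔n k l) q
                     ; (Fin.suc i) → mono (Fin.suc i) (ℕ.m≤n⊔m k l) (r i) }

    noChain : (G : ℕ → Generators) → ¬ (∀ n → G (suc n) ≻ G n)
    noChain G inc =
      let m , g , g∈ , gen = isNoetherian (union G inc)
          k , h = bound (λ k i → g i ∈ span (G k))
                        (λ i le p → span-mono G inc (ℕ.≤⇒≤′ le) p) g∈
          _ , x , x∈ , x∉ = inc k
          a , p = gen (suc k , x∈)
      in x∉ (Ideal.resp (span (G k)) (sym p) (sum-∈ (span (G k)) a g h))

  ≻-wellFounded : WellFounded _≻_
  ≻-wellFounded G₀ = stable λ ¬acc →
    noChain (proj₁ ∘ chain ¬acc) (λ n → proj₁ (proj₂ (next (chain ¬acc n))))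
    where
    NonAcc : Set (c ⊔ ℓ)
    NonAcc = ∃ λ G → ¬ Acc _≻_ G

    next : ((G , _) : NonAcc) → ∃ λ H → H ≻ G × ¬ Acc _≻_ H
    next (G , ¬acc) = stable λ ¬∃ →
      ¬acc (acc λ {H} H≻G → stable λ ¬accH → ¬∃ (H , H≻G , ¬accH))

    chain : ¬ Acc _≻_ G₀ → ℕ → NonAcc
    chain ¬acc zero    = G₀ , ¬acc
    chain ¬acc (suc n) = let H , _ , ¬accH = next (chain ¬acc n) in H , ¬accH

  noetherianInduction : ∀ {p} (P : Ideal R → Set p) →
    (∀ I → (∀ J → I ⊊ J → P J) → P I) → ∀ I → P I
  noetherianInduction P step I = go I _ (≻-wellFounded _) (gens I)
    where
    gens : ∀ I → I ≐ span (proj₁ (isNoetherian I) , proj₁ (proj₂ (isNoetherian I)))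
    gens I = let n , g , g∈ , gen = isNoetherian I in gen , span-⊆ I g∈

    go : ∀ I G → Acc _≻_ G → I ≐ span G → P I
    go I G (acc rs) (I⊆ , ⊆I) = step I λ J (I⊆J , x , x∈J , x∉I) →
      go J _ (rs ((λ p → proj₁ (gens J) (I⊆J (⊆I p))) ,
                  x , proj₁ (gens J) x∈J , λ p → x∉I (⊆I p))) (gens J)

  maximal⇒prime : ∀ {M : Ideal R} → IsMaximal M → IsPrime M
  maximal⇒prime {M} max = record { proper = IsMaximal.proper max ; prime = prime }
    where
    prime : ∀ {x y} → x * y ∈ M → x ∈ M ⊎ y ∈ M
    prime {x} {y} xy∈ with excludedMiddle {x ∈ M} | excludedMiddle {1# ∈ adjoin M x}
    ... | yes x∈ | _     = inj₁ x∈
    ... | no x∉  | no 1∉ =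
      contradiction (IsMaximal.maximal max (adjoin M x) (⊆-adjoin M x) 1∉ (x∈adjoin M x)) x∉
    ... | no _   | yes (t , r , t∈ , p) = inj₂ (Ideal.resp M
      (sym (trans (sym (*-identityˡ y)) (trans (*-congʳ p)
        (Id.identity4 t r x y))))
      (Ideal.+-closed M (Ideal.*-closed M y t∈) (Ideal.*-closed M r xy∈)))

  ∃-maximal : ∀ (I : Ideal R) → IsProper I → ∃ λ (M : Ideal R) → IsMaximal M × I ⊆ M
  ∃-maximal = noetherianInduction (λ I → IsProper I → ∃ λ (M : Ideal R) → IsMaximal M × I ⊆ M) step
    where
    step : ∀ I → (∀ J → I ⊊ J → IsProper J → ∃ λ (M : Ideal R) → IsMaximal M × J ⊆ M) →
           IsProper I → ∃ λ (M : Ideal R) → IsMaximal M × I ⊆ M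
    step I rec 1∉ with excludedMiddle {∃ λ x → x ∉ I × 1# ∉ adjoin I x}
    ... | yes (x , x∉ , 1∉′) =
      let M , max , J⊆M = rec (adjoin I x) (⊊-adjoin I x x∉) 1∉′
      in M , max , λ p → J⊆M (⊆-adjoin I x p)
    ... | no ¬∃ = I , record { proper = 1∉ ; maximal = maximal } , λ p → p
      where
      maximal : ∀ J → I ⊆ J → IsProper J → J ⊆ I
      maximal J I⊆J 1∉J {x} x∈J = stable λ x∉I → ¬∃ (x , x∉I , λ (i , a , i∈ , p) →
        1∉J (Ideal.resp J (sym p) (Ideal.+-closed J (I⊆J i∈) (Ideal.*-closed J a x∈J))))

  NonZeroPrime : Ideal R → Set (c ⊔ ℓ)
  NonZeroPrime P = IsPrime P × IsNonZero P

  ∃-∏primes : ∀ (I : Ideal R) → IsNonZero I → ∃ λ (Ps : List (Ideal R)) → All NonZeroPrime Ps × ∏ Ps ⊆ I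
  ∃-∏primes = noetherianInduction Q step
    where
    Q : Ideal R → Set _
    Q I = IsNonZero I → ∃ λ (Ps : List (Ideal R)) → All NonZeroPrime Ps × ∏ Ps ⊆ I

    step : ∀ I → (∀ J → I ⊊ J → Q J) → Q I
    step I rec (z , z∈ , z≉0) with excludedMiddle {1# ∈ I}
    ... | yes 1∈ = [] , [] , λ _ → 1∈⇒∈ I 1∈
    ... | no 1∉ with excludedMiddle {∃₂ λ x y → x * y ∈ I × x ∉ I × y ∉ I}
    ...   | no ¬∃ = I ∷ [] , (record { proper = 1∉ ; prime = prime } , z , z∈ , z≉0) ∷ [] ,
                    ⊛-⊆ I (λ x∈ _ → *-closedʳ I _ x∈)
      where
      prime : ∀ {x y} → x * y ∈ I → x ∈ I ⊎ y ∈ I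
      prime {x} {y} xy∈ with excludedMiddle {x ∈ I}
      ... | yes x∈ = inj₁ x∈
      ... | no x∉  = inj₂ (stable λ y∉ → ¬∃ (x , y , xy∈ , x∉ , y∉))
    ...   | yes (x , y , xy∈ , x∉ , y∉) =
      let Ps , Ps! , Ps⊆ = rec (adjoin I x) (⊊-adjoin I x x∉) (z , ⊆-adjoin I x z∈ , z≉0)
          Qs , Qs! , Qs⊆ = rec (adjoin I y) (⊊-adjoin I y y∉) (z , ⊆-adjoin I y z∈ , z≉0)
      in Ps ++ Qs , All.++⁺ Ps! Qs! , split Ps Qs Ps⊆ Qs⊆
      where
      mul : ∀ {v w} → v ∈ adjoin I x → w ∈ adjoin I y → v * w ∈ I
      mul {v} {w} (i , a , i∈ , p) (j , b , j∈ , q) = Ideal.resp I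
        (sym (trans (*-cong p q) (Id.identity5 i a x j b y)))
        (Ideal.+-closed I (Ideal.*-closed I _ i∈)
          (Ideal.+-closed I (Ideal.*-closed I _ j∈) (Ideal.*-closed I _ xy∈)))

      split : ∀ (Ps Qs : List (Ideal R)) → ∏ Ps ⊆ adjoin I x → ∏ Qs ⊆ adjoin I y → ∏ (Ps ++ Qs) ⊆ I
      split Ps Qs Ps⊆ Qs⊆ = go Ps {I} (λ {v} {w} v∈ w∈ → mul (Ps⊆ v∈) (Qs⊆ w∈))
        where
        go : ∀ (Ps : List (Ideal R)) {L : Ideal R} →
             (∀ {v w : Carrier} → v ∈ ∏ Ps → w ∈ ∏ Qs → v * w ∈ L) → ∏ (Ps ++ Qs) ⊆ L
        go []       {L} f {w} w∈ = Ideal.resp L (*-identityˡ w) (f (∈-unit {R = R} {x = 1#}) w∈)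
        go (P ∷ Ps) {L} f = ⊛-⊆ L λ {u} u∈ w∈ → go Ps {colon u} (λ {v} {w} v∈ w∈ →
          Ideal.resp L (*-assoc u v w) (f (⊛-mem u∈ v∈) w∈)) w∈
          where
          -- { w | u * w ∈ L }
          colon : Carrier → Ideal R
          colon u = record
            { Member   = λ w → u * w ∈ L
            ; resp     = λ e → Ideal.resp L (*-congˡ e)
            ; 0#-mem   = Ideal.resp L (sym (zeroʳ u)) (Ideal.0#-mem L)
            ; +-closed = λ p q → Ideal.resp L (sym (distribˡ u _ _)) (Ideal.+-closed L p q)
            ; *-closed = λ r {x} p → Ideal.resp L
                (Id.identity6 r u x)
                (Ideal.*-closed L r p)
            }

  -- Integrality: if (c / b) I ⊆ I for some nonzero ideal I, then b divides c.

  private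
    ⟨_⟩ : Carrier → Ideal R
    ⟨_⟩ = principal

    firstTerms : (ℕ → Carrier) → ℕ → Generators
    firstTerms z n = n , λ i → z (toℕ i)

    firstTerms-mono : ∀ z {m n} → m ≤ n → span (firstTerms z m) ⊆ span (firstTerms z n)
    firstTerms-mono z {n = n} ℕ.z≤n (a , p) =
      Ideal.resp (span (firstTerms z n)) (sym p) (Ideal.0#-mem (span (firstTerms z n)))
    firstTerms-mono z (ℕ.s≤s le) (a , p) =
      let b , q = firstTerms-mono (z ∘ suc) le (a ∘ Fin.suc , refl)
      in a Fin.zero Vector.∷ b , trans p (+-congˡ q)

    ∈-firstTerms : ∀ z n → z n ∈ span (firstTerms z (suc n))
    ∈-firstTerms z zero    = (λ _ → 1#) , sym (trans (+-identityʳ _) (*-identityˡ _))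
    ∈-firstTerms z (suc n) =
      let a , p = ∈-firstTerms (z ∘ suc) n
      in 0# Vector.∷ a , trans p (sym (trans (+-congʳ (zeroˡ _)) (+-identityˡ _)))

    dependence : ∀ z → ∃ λ n → z n ∈ span (firstTerms z n)
    dependence z =
      let m , g , g∈ , gen = isNoetherian all
          k , h = bound (λ k i → g i ∈ span (firstTerms z k))
                        (λ i le → firstTerms-mono z le) g∈
          a , p = gen (suc k , ∈-firstTerms z k)
      in k , Ideal.resp (span (firstTerms z k)) (sym p) (sum-∈ (span (firstTerms z k)) a g h)
      where
      all : Ideal R
      all = record
        { Member   = λ x → ∃ λ n → x ∈ span (firstTerms z n)
        ; resp     = λ e (n , p) → n , Ideal.resp (span (firstTerms z n)) e p
        ; 0#-mem   = 0 , Ideal.0#-mem (span (firstTerms z 0))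
        ; +-closed = λ (m , p) (n , q) → m ℕ.⊔ n ,
            Ideal.+-closed (span (firstTerms z (m ℕ.⊔ n)))
              (firstTerms-mono z (ℕ.m≤m⊔n m n) p) (firstTerms-mono z (ℕ.m≤n⊔m m n) q)
        ; *-closed = λ r (n , p) → n , Ideal.*-closed (span (firstTerms z n)) r p
        }

    module K = CommutativeRing K
    module KI = Identities K.commutativeSemiring
    open Exp K.semiring using (_^_)
    open IsFractionField F using (ι; isField; isRingMonomorphism)
    module ι = RingMorphisms.IsRingMonomorphism isRingMonomorphism
    open Sum K.semiring using () renaming (sum to sumᴷ)

    relation : ∀ n (z : ℕ → Carrier) (f : ℕ → K.Carrier) t →
      (∀ i → ι (z i) K.≈ f i K.* t) → ∀ {w} → w ∈ span (firstTerms z n) →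
      ∃ λ (a : Vector Carrier n) → ι w K.+ sumᴷ (λ i → ι (a i) K.* f (toℕ i)) K.* t K.≈ K.0#
    relation zero z f t h (a , p) = a ,
      K.trans (K.+-cong (K.trans (ι.⟦⟧-cong p) ι.0#-homo) (K.zeroˡ t)) (K.+-identityˡ K.0#)
    relation (suc n) z f t h {w} (a , p) =
      let a₀ = a Fin.zero
          w′ = sum (λ i → a (Fin.suc i) * z (suc (toℕ i)))
          b , q = relation n (z ∘ suc) (f ∘ suc) t (h ∘ suc) {w′} (a ∘ Fin.suc , refl)
          ιw : ι w K.≈ ι a₀ K.* (f 0 K.* t) K.+ ι w′
          ιw = K.trans (ι.⟦⟧-cong p) (K.trans (ι.+-homo _ _)
                 (K.+-congʳ (K.trans (ι.*-homo _ _) (K.*-congˡ (h 0)))))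
          a+-a : ι a₀ K.+ ι (- a₀) K.≈ K.0#
          a+-a = K.trans (K.sym (ι.+-homo _ _))
                   (K.trans (ι.⟦⟧-cong (-‿inverseʳ a₀)) ι.0#-homo)
      in (- a₀) Vector.∷ b ,
         K.trans (K.+-congʳ ιw)
        (K.trans (KI.identity10 _ _ _ _ _ _)
        (K.trans (K.+-cong (K.trans (K.*-congʳ a+-a) (K.zeroˡ _)) q) (K.+-identityˡ K.0#)))

    K-cancelʳ : ∀ {y t} → ¬ t K.≈ K.0# → y K.* t K.≈ K.0# → y K.≈ K.0#
    K-cancelʳ {y} {t} t≉0 p =
      let u , q = IsField.inverse isField t≉0
      in K.trans (K.sym (K.*-identityʳ y)) (K.trans (K.*-congˡ (K.sym q))
           (K.trans (K.sym (K.*-assoc y t u)) (K.trans (K.*-congʳ p) (K.zeroˡ u))))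

    ι-nonzero : ∀ {r} → ¬ r ≈ 0# → ¬ ι r K.≈ K.0#
    ι-nonzero r≉0 p = r≉0 (ι.injective (K.trans p (K.sym ι.0#-homo)))

  stable⇒divides : ∀ (I : Ideal R) b c → ¬ b ≈ 0# → IsNonZero I →
    (∀ {y} → y ∈ I → ∃ λ z → z ∈ I × c * y ≈ b * z) → c ∈ ⟨ b ⟩
  stable⇒divides I b c b≉0 (y₀ , y₀∈ , y₀≉0) step =
    let N , zN∈ = dependence z
        a , rel = relation N z (x ^_) t z≈ zN∈
        r , ιr≈x = isIntegrallyClosed x (N , a ,
          K-cancelʳ (ι-nonzero y₀≉0)
            (K.trans (K.distribʳ t _ _) (K.trans (K.+-congʳ (K.sym (z≈ N))) rel)))
    in r , ι.injective (K.sym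
         (K.trans (ι.*-homo r b) (K.trans (K.*-congʳ ιr≈x)
         (K.trans (K.*-assoc (ι c) b⁻¹ (ι b)) (K.trans (K.*-congˡ
           (K.trans (K.*-comm b⁻¹ (ι b)) bb⁻¹)) (K.*-identityʳ (ι c)))))))
    where
    b⁻¹ = proj₁ (IsField.inverse isField (ι-nonzero b≉0))
    bb⁻¹ = proj₂ (IsField.inverse isField (ι-nonzero b≉0))
    x = ι c K.* b⁻¹
    t = ι y₀

    seq : ℕ → ∃ λ y → y ∈ I
    seq zero    = y₀ , y₀∈
    seq (suc n) = let z , z∈ , _ = step (proj₂ (seq n)) in z , z∈

    z : ℕ → Carrier
    z n = proj₁ (seq n)

    z≈ : ∀ n → ι (z n) K.≈ x ^ n K.* t
    z≈ zero    = K.sym (K.*-identityˡ t)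
    z≈ (suc n) =
      let _ , _ , e = step (proj₂ (seq n))
      in K.trans (K.sym (K.*-identityˡ _)) (K.trans (K.*-congʳ (K.sym bb⁻¹))
        (K.trans (K.sym (KI.identity8 _ _ _))
        (K.trans (K.*-congˡ (K.trans (K.sym (ι.*-homo _ _))
                 (K.trans (ι.⟦⟧-cong (sym e)) (K.trans (ι.*-homo _ _) (K.*-congˡ (z≈ n))))))
                 (KI.identity9 _ _ _ _))))

  -- For a maximal M ≠ 0 there are b and c with (c / b) M ⊆ R but c / b ∉ R.

  private
    ∏-remove : ∀ {M : Ideal R} → IsPrime M → ∀ Ps → All NonZeroPrime Ps → ∏ Ps ⊆ M →
      ∃₂ λ (P : Ideal R) (Qs : List (Ideal R)) → NonZeroPrime P × All NonZeroPrime Qs × P ⊆ M ×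
        length Ps ≡ suc (length Qs) × (∀ {x y} → x ∈ ∏ Qs → y ∈ P → x * y ∈ ∏ Ps)
    ∏-remove M! [] [] ⊆M = contradiction (⊆M (∈-unit {R = R} {x = 1#})) (IsPrime.proper M!)
    ∏-remove {M} M! (P ∷ Ps) (P! ∷ Ps!) ⊆M with excludedMiddle {P ⊆ M}
    ... | yes P⊆M = P , Ps , P! , Ps! , P⊆M , ≡.refl ,
      λ {x} {y} x∈ y∈ → Ideal.resp (P ⊛ ∏ Ps) (*-comm y x) (⊛-mem y∈ x∈)
    ... | no P⊈M =
      let x , x∈P , x∉M = ¬⊆⇒∃ {P} {M} P⊈M
          P′ , Qs , P′! , Qs! , P′⊆M , len , mul = ∏-remove M! Ps Ps! λ {y} y∈ →
            other x∉M (IsPrime.prime M! (⊆M (⊛-mem x∈P y∈)))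
      in P′ , P ∷ Qs , P′! , P! ∷ Qs! , P′⊆M , ≡.cong suc len , mul′ {P′} {Qs} mul
      where
      other : ∀ {x y} → x ∉ M → x ∈ M ⊎ y ∈ M → y ∈ M
      other x∉ (inj₁ x∈) = contradiction x∈ x∉
      other x∉ (inj₂ y∈) = y∈

      mul′ : ∀ {P′ : Ideal R} {Qs : List (Ideal R)} → (∀ {x y} → x ∈ ∏ Qs → y ∈ P′ → x * y ∈ ∏ Ps) →
             ∀ {x y} → x ∈ P ⊛ ∏ Qs → y ∈ P′ → x * y ∈ P ⊛ ∏ Ps
      mul′ mul {y = y} (nil p) y∈ = nil (trans (*-congʳ p) (zeroˡ y))
      mul′ {P′} {Qs} mul {y = y} (cons a∈ b∈ w∈ p) y∈ =
        cons a∈ (mul b∈ y∈) (mul′ {P′} {Qs} mul w∈ y∈)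
             (trans (*-congʳ p) (Id.identity3 _ _ _ y))

  inverseFraction : ∀ {M : Ideal R} → IsMaximal M → IsNonZero M →
    ∃₂ λ b c → ¬ b ≈ 0# × c ∉ ⟨ b ⟩ × (∀ {y} → y ∈ M → ∃ λ z → c * y ≈ b * z)
  inverseFraction {M} max (b , b∈ , b≉0) =
    let Ps , Ps! , Ps⊆ = ∃-∏primes ⟨ b ⟩ (b , (1# , sym (*-identityˡ b)) , b≉0)
        c , c∉ , f = descend (length Ps) Ps ≡.refl Ps! Ps⊆
    in b , c , b≉0 , c∉ , f
    where
    M! : IsPrime M
    M! = maximal⇒prime max

    b⊆M : ⟨ b ⟩ ⊆ M
    b⊆M (a , p) = Ideal.resp M (sym p) (Ideal.*-closed M a b∈)

    descend : ∀ n Ps → length Ps ≡ n → All NonZeroPrime Ps → ∏ Ps ⊆ ⟨ b ⟩ →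
              ∃ λ c → c ∉ ⟨ b ⟩ × (∀ {y} → y ∈ M → ∃ λ z → c * y ≈ b * z)
    descend n Ps len Ps! Ps⊆ with ∏-remove M! Ps Ps! (λ p → b⊆M (Ps⊆ p))
    ... | P , Qs , (P! , P≠0) , Qs! , P⊆M , len′ , mul
      with excludedMiddle {∏ Qs ⊆ ⟨ b ⟩}
    ...   | no Qs⊈ =
      let c , c∈ , c∉ = ¬⊆⇒∃ {∏ Qs} {⟨ b ⟩} Qs⊈
          M⊆P = IsMaximal.maximal (dimension≤1 P P! P≠0) M P⊆M (IsMaximal.proper max)
      in c , c∉ , λ {y} y∈ → let a , p = Ps⊆ (mul c∈ (M⊆P y∈)) in a , trans p (*-comm a b)
    descend zero    Ps len Ps! Ps⊆ | P , Qs , _ , Qs! , _ , len′ , _ | yes Qs⊆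
      with () ← ≡.trans (≡.sym len) len′
    descend (suc n) Ps len Ps! Ps⊆ | P , Qs , _ , Qs! , _ , len′ , _ | yes Qs⊆ =
      descend n Qs (ℕ.suc-injective (≡.trans (≡.sym len′) len)) Qs! Qs⊆

  -- (I + (c / b) I) ∩ R
  enlarge : Carrier → Carrier → Ideal R → Ideal R
  enlarge b c I = record
    { Member   = λ w → ∃₂ λ i u → ∃ λ j → i ∈ I × j ∈ I × w ≈ i + u × b * u ≈ c * j
    ; resp     = λ e (i , u , j , i∈ , j∈ , p , q) → i , u , j , i∈ , j∈ , trans (sym e) p , q
    ; 0#-mem   = 0# , 0# , 0# , Ideal.0#-mem I , Ideal.0#-mem I , sym (+-identityˡ 0#) ,
                 trans (zeroʳ b) (sym (zeroʳ c))
    ; +-closed = λ (i , u , j , i∈ , j∈ , p , q) (i′ , u′ , j′ , i′∈ , j′∈ , p′ , q′) →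
        i + i′ , u + u′ , j + j′ , Ideal.+-closed I i∈ i′∈ , Ideal.+-closed I j∈ j′∈ ,
        trans (+-cong p p′) (Id.identity11 i u i′ u′) ,
        trans (distribˡ b u u′) (trans (+-cong q q′) (sym (distribˡ c j j′)))
    ; *-closed = λ r (i , u , j , i∈ , j∈ , p , q) →
        r * i , r * u , r * j , Ideal.*-closed I r i∈ , Ideal.*-closed I r j∈ ,
        trans (*-congˡ p) (distribˡ r i u) ,
        trans (Id.identity6 b r u) (trans (*-congˡ q) (Id.identity6 r c j))
    }

  ⊆-enlarge : ∀ b c I → I ⊆ enlarge b c I
  ⊆-enlarge b c I {i} i∈ = i , 0# , 0# , i∈ , Ideal.0#-mem I , sym (+-identityʳ i) ,
    trans (zeroʳ b) (sym (zeroʳ c))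

  ∈-enlarge : ∀ b c I {u j} → j ∈ I → b * u ≈ c * j → u ∈ enlarge b c I
  ∈-enlarge b c I {u} {j} j∈ q =
    0# , u , j , Ideal.0#-mem I , j∈ , sym (+-identityˡ u) , q

  -- A nonzero ideal inside a maximal ideal M is M ⊛ J for a larger ideal J.
  divide : ∀ {M I : Ideal R} → IsMaximal M → IsNonZero I → I ⊆ M →
           ∃ λ (J : Ideal R) → I ⊊ J × I ≐ M ⊛ J
  divide {M} {I} max I≠0@(z , z∈ , z≉0) I⊆M =
    J , (⊆-enlarge d n I , ¬⊆⇒∃ {J} {I} J⊈I) , I⊆MJ , MJ⊆I
    where
    n/d = inverseFraction {M} max (z , I⊆M z∈ , z≉0)
    d = proj₁ n/d
    n = proj₁ (proj₂ n/d)
    d≉0 = proj₁ (proj₂ (proj₂ n/d))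
    n∉d = proj₁ (proj₂ (proj₂ (proj₂ n/d)))

    scale : ∀ {y} → y ∈ M → ∃ λ z → n * y ≈ d * z
    scale = proj₂ (proj₂ (proj₂ (proj₂ n/d)))

    J : Ideal R
    J = enlarge d n I

    notStable : ∀ {L : Ideal R} → IsNonZero L → L ⊆ M → ¬ (enlarge d n L ⊆ L)
    notStable {L} L≠0 L⊆M h = n∉d (stable⇒divides L d n d≉0 L≠0 λ y∈ →
      let z , e = scale (L⊆M y∈) in z , h (∈-enlarge d n L y∈ (sym e)) , e)

    J⊈I : ¬ (J ⊆ I)
    J⊈I = notStable {I} I≠0 I⊆M

    1∈ : 1# ∈ enlarge d n M
    1∈ = stable λ 1∉ → notStable {M} (z , I⊆M z∈ , z≉0) (λ p → p)
           (IsMaximal.maximal max (enlarge d n M) (⊆-enlarge d n M) 1∉)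

    MJ⊆I : M ⊛ J ⊆ I
    MJ⊆I = ⊛-⊆ I λ {y} {w} y∈ (i , u , j , i∈ , j∈ , p , q) →
      let y′ , e = scale y∈
          yu≈ : y * u ≈ y′ * j
          yu≈ = *-cancelˡ d≉0 (trans (Id.identity6 d y u) (trans (*-congˡ q)
                  (trans (Id.identity8 y n j) (trans (*-congʳ e) (*-assoc d y′ j)))))
      in Ideal.resp I (sym (trans (*-congˡ p) (trans (distribˡ y i u) (+-congˡ yu≈))))
           (Ideal.+-closed I (Ideal.*-closed I y i∈) (Ideal.*-closed I y′ j∈))

    I⊆MJ : I ⊆ M ⊛ J
    I⊆MJ {x} x∈ =
      let t , u , y , t∈ , y∈ , p , q = 1∈
          u′ , e = scale (I⊆M x∈)
          xu≈ : x * u ≈ y * u′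
          xu≈ = *-cancelˡ d≉0 (trans (Id.identity6 d x u) (trans (*-congˡ q)
                  (trans (sym (trans (Id.identity6 y n x) (trans (*-congˡ (*-comm y x))
                    (sym (Id.identity6 x n y))))) (trans (*-congˡ e) (Id.identity6 y d u′)))))
      in Ideal.resp (M ⊛ J)
           (sym (trans (sym (*-identityʳ x)) (trans (*-congˡ p)
             (trans (distribˡ x t u) (+-cong (*-comm x t) xu≈)))))
           (Ideal.+-closed (M ⊛ J) (⊛-mem t∈ (⊆-enlarge d n I x∈))
             (⊛-mem y∈ (∈-enlarge d n I x∈ (sym e))))

  private
    ⊛-monoʳ : ∀ (I J L : Ideal R) → J ⊆ L → I ⊛ J ⊆ I ⊛ L
    ⊛-monoʳ I J L J⊆L = ⊛-⊆ {I = I} {J = J} (I ⊛ L) (λ y∈ w∈ → ⊛-mem {I = I} {J = L} y∈ (J⊆L w∈))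

    prepend : ∀ (M I J : Ideal R) → IsMaximal M → I ≐ M ⊛ J →
              MaximalFactorisation J → MaximalFactorisation I
    prepend M I J max (I⊆MJ , MJ⊆I) f = record
      { factors   = M ∷ factors
      ; maximal   = max ∷ maximal
      ; product-≐ = (λ x∈ → ⊛-monoʳ M J (∏ factors) (proj₁ product-≐) (I⊆MJ x∈)) ,
                    (λ x∈ → MJ⊆I (⊛-monoʳ M (∏ factors) J (proj₂ product-≐) x∈))
      }
      where open MaximalFactorisation f

  maximalFactorisation : ∀ (I : Ideal R) → IsNonZero I → MaximalFactorisation I
  maximalFactorisation = noetherianInduction (λ I → IsNonZero I → MaximalFactorisation I) step
    where
    step : ∀ (I : Ideal R) → (∀ (J : Ideal R) → I ⊊ J → IsNonZero J → MaximalFactorisation J) →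
           IsNonZero I → MaximalFactorisation I
    step I rec I≠0@(z , z∈ , z≉0) with excludedMiddle {1# ∈ I}
    ... | yes 1∈ = record
      { factors   = []
      ; maximal   = []
      ; product-≐ = (λ {x} _ → ∈-unit {R = R} {x = x}) , (λ _ → 1∈⇒∈ I 1∈)
      }
    ... | no 1∉ =
      let M , max , I⊆M = ∃-maximal I 1∉
          J , I⊊J , I≐MJ = divide {M} {I} max I≠0 I⊆M
      in prepend M I J max I≐MJ (rec J I⊊J (z , proj₁ I⊊J z∈ , z≉0))

module _ {c ℓ c′ ℓ′} {R : CommutativeRing c ℓ} {K : CommutativeRing c′ ℓ′}
         {F : IsFractionField R K} (D : IsDedekindDomain F) where

  private
    module R = CommutativeRing R
    module K = CommutativeRing K
  open Factorisation F D using (excludedMiddle; _≈?_; maximalFactorisation)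
  open IsFractionField F

  multiplicity : Ideal R → List (Ideal R) → ℕ
  multiplicity M Ps = length (filter (λ P → excludedMiddle {P ≐ M}) Ps)

  exponent : Ideal R → ∀ r → ¬ r R.≈ R.0# → ℕ
  exponent M r r≉0 = multiplicity M (MaximalFactorisation.factors
    (maximalFactorisation (principal r) (r , (R.1# , R.sym (R.*-identityˡ r)) , r≉0)))

  -- The fraction r / s and the factorisations of (r) and (s) are those produced
  -- by the hypotheses; by unique factorisation the value does not depend on them.
  adicValuation : Ideal R → K.Carrier → ℤₘ₀
  adicValuation M x with fraction x
  ... | r , s , s≉0 , _ with r ≈? R.0#
  ...   | yes _  = 𝟎
  ...   | no r≉0 = of-add (ℤ.- (+ exponent M r r≉0 ℤ.- + exponent M s s≉0))

{-# OPTIONS --safe #-}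
-- Factoring (z) = M J for some 0 ≠ z ∈ M and writing z as a sum of products from
-- M and J, one of these products is u z with u ∉ M; its factor π in M satisfies
-- u M ⊆ (π), so π generates M in the localisation at M. Hence r has exponent n
-- iff s r = t πⁿ for some s, t ∉ M, and this description makes the laws of a
-- valuation elementary, with no need for unique factorisation. All powers of π
-- and their inverses are values, whence surjectivity.
module Submission where

open import Level using (Level; _⊔_)
open import Algebra.Bundles using (CommutativeRing; CommutativeSemiring)
open import Algebra.Morphism.Structures using (module RingMorphisms)
import Algebra.Construct.NaturalChoice.Max as Max
import Algebra.Properties.CommutativeSemigroup as CommutativeSemigroupProperties
import Algebra.Properties.Ring as RingProperties
import Algebra.Properties.Semiring.Exp as Exp
import Algebra.Solver.Ring.NaturalCoefficients.Default as SemiringSolver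
open import Data.Integer.Base as ℤ using (+_; -[1+_]; _⊖_)
import Data.Integer.Properties as ℤ
open import Data.List.Base using (List; []; _∷_; filter; length)
open import Data.List.Relation.Unary.All using (All; []; _∷_)
open import Data.Nat.Base as ℕ using (ℕ; zero; suc; _≤_)
import Data.Nat.Properties as ℕ
open import Data.Product.Base using (∃; ∃₂; _×_; _,_; proj₁; proj₂)
open import Data.Sum.Base using (_⊎_; inj₁; inj₂; [_,_]′)
open import Relation.Binary.Bundles using (TotalOrder)
open import Relation.Binary.Construct.Add.Infimum.NonStrict ℤ._≤_ using (⊥₋≤_; [_])
open import Relation.Binary.PropositionalEquality
  using (_≡_; refl; sym; trans; cong; cong₂; subst; subst₂)
import Relation.Binary.Reasoning.Setoid as SetoidReasoning
open import Relation.Nullary.Decidable.Core using (Dec; yes; no; decidable-stable)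
open import Relation.Nullary.Negation.Core using (¬_; contradiction)
open import Defs

-- Differences of natural numbers, and the order on `ℤₘ₀`.

⊖-cross-≤ : ∀ a b c d → a ℕ.+ d ≤ c ℕ.+ b → a ⊖ b ℤ.≤ c ⊖ d
⊖-cross-≤ a b c d le = begin
  a ⊖ b                     ≡⟨ ℤ.+-cancelˡ-⊖ d a b ⟨
  (d ℕ.+ a) ⊖ (d ℕ.+ b)     ≡⟨ cong (_⊖ (d ℕ.+ b)) (ℕ.+-comm d a) ⟩
  (a ℕ.+ d) ⊖ (d ℕ.+ b)     ≤⟨ ℤ.⊖-monoˡ-≤ (d ℕ.+ b) le ⟩
  (c ℕ.+ b) ⊖ (d ℕ.+ b)     ≡⟨ cong₂ _⊖_ (ℕ.+-comm c b) (ℕ.+-comm d b) ⟩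
  (b ℕ.+ c) ⊖ (b ℕ.+ d)     ≡⟨ ℤ.+-cancelˡ-⊖ b c d ⟩
  c ⊖ d                     ∎
  where open ℤ.≤-Reasoning

⊖-cross-≡ : ∀ a b c d → a ℕ.+ d ≡ c ℕ.+ b → a ⊖ b ≡ c ⊖ d
⊖-cross-≡ a b c d e = ℤ.≤-antisym
  (⊖-cross-≤ a b c d (ℕ.≤-reflexive e)) (⊖-cross-≤ c d a b (ℕ.≤-reflexive (sym e)))

⊖-+-⊖ : ∀ a b c d → (a ⊖ b) ℤ.+ (c ⊖ d) ≡ (a ℕ.+ c) ⊖ (b ℕ.+ d)
⊖-+-⊖ a b c d = begin-equality
  (a ⊖ b) ℤ.+ (c ⊖ d)                  ≡⟨ cong₂ ℤ._+_ (ℤ.m-n≡m⊖n a b) (ℤ.m-n≡m⊖n c d) ⟨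
  (+ a ℤ.- + b) ℤ.+ (+ c ℤ.- + d)      ≡⟨ interchange (+ a) (ℤ.- + b) (+ c) (ℤ.- + d) ⟩
  + (a ℕ.+ c) ℤ.+ (ℤ.- + b ℤ.- + d)    ≡⟨ cong (ℤ._+_ (+ (a ℕ.+ c))) (ℤ.neg-distrib-+ (+ b) (+ d)) ⟨
  + (a ℕ.+ c) ℤ.- + (b ℕ.+ d)          ≡⟨ ℤ.m-n≡m⊖n (a ℕ.+ c) (b ℕ.+ d) ⟩
  (a ℕ.+ c) ⊖ (b ℕ.+ d)                ∎
  where
  open CommutativeSemigroupProperties ℤ.+-commutativeSemigroup using (interchange)
  open ℤ.≤-Reasoning

-- The shape in which the ultrametric estimate arises in `hasValue-+`: `k` is the order of the other
-- summand's denominator, which enters both sides when fractions are brought to a common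
-- denominator.
+-cancel-≤ : ∀ a b k a′ b′ → (a ℕ.+ k) ℕ.+ b′ ≤ a′ ℕ.+ (b ℕ.+ k) → b′ ℕ.+ a ≤ b ℕ.+ a′
+-cancel-≤ a b k a′ b′ le = ℕ.+-cancelʳ-≤ k (b′ ℕ.+ a) (b ℕ.+ a′) (begin
  (b′ ℕ.+ a) ℕ.+ k      ≡⟨ ℕ.+-assoc b′ a k ⟩
  b′ ℕ.+ (a ℕ.+ k)      ≡⟨ ℕ.+-comm b′ (a ℕ.+ k) ⟩
  (a ℕ.+ k) ℕ.+ b′      ≤⟨ le ⟩
  a′ ℕ.+ (b ℕ.+ k)      ≡⟨ ℕ.+-assoc a′ b k ⟨
  (a′ ℕ.+ b) ℕ.+ k      ≡⟨ cong (ℕ._+ k) (ℕ.+-comm a′ b) ⟩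
  (b ℕ.+ a′) ℕ.+ k      ∎)
  where open ℕ.≤-Reasoning

≤-max : ∀ {u v w : ℤₘ₀} → u ≤ₘ₀ v ⊎ u ≤ₘ₀ w → u ≤ₘ₀ max v w
≤-max {v = v} {w} =
  [ (λ p → ≤.trans p (MaxP.x≤x⊔y v w)) , (λ p → ≤.trans p (MaxP.x≤y⊔x v w)) ]′
  where
  module ≤ = TotalOrder ℤₘ₀-totalOrder
  module MaxP = Max ℤₘ₀-totalOrder

-- Identities in commutative semirings.

module ProductIdentities {c ℓ} (A : CommutativeSemiring c ℓ) where

  open CommutativeSemiring A renaming (refl to ≈-refl)
  open SemiringSolver A using (solve; _:+_; _:*_; _:=_)

  xy∙zw≈xz∙yw : ∀ x y z w → (x * y) * (z * w) ≈ (x * z) * (y * w)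
  xy∙zw≈xz∙yw = solve 4 (λ x y z w → (x :* y) :* (z :* w) := (x :* z) :* (y :* w)) ≈-refl

  x∙yz≈xz∙y : ∀ x y z → x * (y * z) ≈ (x * z) * y
  x∙yz≈xz∙y = solve 3 (λ x y z → x :* (y :* z) := (x :* z) :* y) ≈-refl

  x∙yz≈z∙xy : ∀ x y z → x * (y * z) ≈ z * (x * y)
  x∙yz≈z∙xy = solve 3 (λ x y z → x :* (y :* z) := z :* (x :* y)) ≈-refl

  x∙yz≈y∙xz : ∀ x y z → x * (y * z) ≈ y * (x * z)
  x∙yz≈y∙xz = solve 3 (λ x y z → x :* (y :* z) := y :* (x :* z)) ≈-refl

  x[y∙zwv]≈w∙xyvz : ∀ x y z w v → x * (y * ((z * w) * v)) ≈ w * ((x * y * v) * z)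
  x[y∙zwv]≈w∙xyvz = solve 5 (λ x y z w v →
    x :* (y :* ((z :* w) :* v)) := w :* ((x :* y :* v) :* z)) ≈-refl

  common-denominator : ∀ s s′ r r′ → (s * s′) * (r + r′) ≈ s′ * (s * r) + s * (s′ * r′)
  common-denominator = solve 4 (λ s s′ r r′ →
    (s :* s′) :* (r :+ r′) := s′ :* (s :* r) :+ s :* (s′ :* r′)) ≈-refl

  sum-of-fractions : ∀ x y s s′ → (x + y) * (s * s′) ≈ (x * s) * s′ + (y * s′) * s
  sum-of-fractions = solve 4 (λ x y s s′ →
    (x :+ y) :* (s :* s′) := (x :* s) :* s′ :+ (y :* s′) :* s) ≈-refl

-- Cancellation and nonzero products in a domain.

module _ {c ℓ} {R : CommutativeRing c ℓ} (isDomain : IsDomain R) where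

  open CommutativeRing R renaming (refl to ≈-refl; sym to ≈-sym; trans to ≈-trans)
  open RingProperties ring
  open IsDomain isDomain
  open Exp semiring using (_^_)

  *-cancelˡ : ∀ {b x y} → ¬ b ≈ 0# → b * x ≈ b * y → x ≈ y
  *-cancelˡ {b} {x} {y} b≉0 e with noZeroDivisor {b} {x - y}
    (≈-trans (x[y-z]≈xy-xz b x y) (x≈y⇒x∙y⁻¹≈ε e))
  ... | inj₁ b≈0 = contradiction b≈0 b≉0
  ... | inj₂ p   = x∙y⁻¹≈ε⇒x≈y x y p

  *-nonzero : ∀ {x y} → ¬ x ≈ 0# → ¬ y ≈ 0# → ¬ x * y ≈ 0#
  *-nonzero x≉0 y≉0 e = [ x≉0 , y≉0 ]′ (noZeroDivisor e)

  ^-nonzero : ∀ {x} → ¬ x ≈ 0# → ∀ n → ¬ x ^ n ≈ 0#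
  ^-nonzero x≉0 zero    = 1≉0
  ^-nonzero x≉0 (suc n) = *-nonzero x≉0 (^-nonzero x≉0 n)

-- Orders of ring elements with respect to a uniformiser.

-- π generates M after localising at M, with a single denominator u.
record Uniformiser {c ℓ} {R : CommutativeRing c ℓ} (M : Ideal R) : Set (c ⊔ ℓ) where
  open CommutativeRing R
  field
    π u     : Carrier
    π∈M     : π ∈ M
    π≉0     : ¬ π ≈ 0#
    u∉M     : u ∉ M
    divides : ∀ {x} → x ∈ M → u * x ∈ principal {R = R} π

module Order {c ℓ} {R : CommutativeRing c ℓ} (isDomain : IsDomain R)
             {M : Ideal R} (M! : IsPrime M) (U : Uniformiser M) where

  open CommutativeRing R renaming (refl to ≈-refl; sym to ≈-sym; trans to ≈-trans)
  open Exp semiring using (_^_; ^-homo-*)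
  open IsPrime M!
  open Uniformiser U
  open SetoidReasoning setoid
  private
    module Id = ProductIdentities commutativeSemiring

    ⟨_⟩ : Carrier → Ideal R
    ⟨_⟩ = principal

  ∉-* : ∀ {x y} → x ∉ M → y ∉ M → x * y ∉ M
  ∉-* x∉ y∉ xy∈ = [ x∉ , y∉ ]′ (prime xy∈)

  ∉-^ : ∀ {x} → x ∉ M → ∀ n → x ^ n ∉ M
  ∉-^ x∉ zero    = proper
  ∉-^ x∉ (suc n) = ∉-* x∉ (∉-^ x∉ n)

  -- Membership of `r` in the ideal generated by `π ^ n` in the localisation at `M`, with the
  -- denominator `s` cleared so that everything stays in `R`.
  record OrderAtLeast (r : Carrier) (n : ℕ) : Set (c ⊔ ℓ) where
    constructor atLeast
    field
      s t : Carrier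
      s∉M : s ∉ M
      s*r≈t*πⁿ : s * r ≈ t * π ^ n

  -- Here `t` too becomes a unit in the localisation, so `r` and `π ^ n` are associates there.
  record HasOrder (r : Carrier) (n : ℕ) : Set (c ⊔ ℓ) where
    constructor exactly
    field
      s t : Carrier
      s∉M : s ∉ M
      t∉M : t ∉ M
      s*r≈t*πⁿ : s * r ≈ t * π ^ n

  hasOrder⇒orderAtLeast : ∀ {r n} → HasOrder r n → OrderAtLeast r n
  hasOrder⇒orderAtLeast (exactly s t s∉ _ e) = atLeast s t s∉ e

  hasOrder-resp : ∀ {r r′ n} → r ≈ r′ → HasOrder r n → HasOrder r′ n
  hasOrder-resp r≈r′ (exactly s t s∉ t∉ e) =
    exactly s t s∉ t∉ (≈-trans (*-congˡ (≈-sym r≈r′)) e)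

  hasOrder-1 : HasOrder 1# 0
  hasOrder-1 = exactly 1# 1# proper proper ≈-refl

  hasOrder-π^ : ∀ n → HasOrder (π ^ n) n
  hasOrder-π^ n = exactly 1# 1# proper proper ≈-refl

  *-equation : ∀ {r r′ s s′ t t′} m n → s * r ≈ t * π ^ m → s′ * r′ ≈ t′ * π ^ n →
               (s * s′) * (r * r′) ≈ (t * t′) * π ^ (m ℕ.+ n)
  *-equation {r} {r′} {s} {s′} {t} {t′} m n e e′ = begin
    (s * s′) * (r * r′)            ≈⟨ Id.xy∙zw≈xz∙yw s s′ r r′ ⟩
    (s * r) * (s′ * r′)            ≈⟨ *-cong e e′ ⟩
    (t * π ^ m) * (t′ * π ^ n)     ≈⟨ Id.xy∙zw≈xz∙yw t (π ^ m) t′ (π ^ n) ⟩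
    (t * t′) * (π ^ m * π ^ n)     ≈⟨ *-congˡ (^-homo-* π m n) ⟨
    (t * t′) * π ^ (m ℕ.+ n)       ∎

  hasOrder-* : ∀ {r r′ m n} → HasOrder r m → HasOrder r′ n → HasOrder (r * r′) (m ℕ.+ n)
  hasOrder-* {m = m} {n} (exactly s t s∉ t∉ e) (exactly s′ t′ s′∉ t′∉ e′) =
    exactly (s * s′) (t * t′) (∉-* s∉ s′∉) (∉-* t∉ t′∉) (*-equation m n e e′)

  orderAtLeast-* : ∀ {r r′ m n} → OrderAtLeast r m → OrderAtLeast r′ n →
                   OrderAtLeast (r * r′) (m ℕ.+ n)
  orderAtLeast-* {m = m} {n} (atLeast s t s∉ e) (atLeast s′ t′ s′∉ e′) =
    atLeast (s * s′) (t * t′) (∉-* s∉ s′∉) (*-equation m n e e′)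

  orderAtLeast-+ : ∀ {r r′ n} → OrderAtLeast r n → OrderAtLeast r′ n → OrderAtLeast (r + r′) n
  orderAtLeast-+ {r} {r′} {n} (atLeast s t s∉ e) (atLeast s′ t′ s′∉ e′) =
    atLeast (s * s′) (s′ * t + s * t′) (∉-* s∉ s′∉) (begin
      (s * s′) * (r + r′)                     ≈⟨ Id.common-denominator s s′ r r′ ⟩
      s′ * (s * r) + s * (s′ * r′)            ≈⟨ +-cong (*-congˡ e) (*-congˡ e′) ⟩
      s′ * (t * π ^ n) + s * (t′ * π ^ n)     ≈⟨ +-cong (*-assoc _ _ _) (*-assoc _ _ _) ⟨
      (s′ * t) * π ^ n + (s * t′) * π ^ n     ≈⟨ distribʳ _ _ _ ⟨
      (s′ * t + s * t′) * π ^ n               ∎)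

  orderAtLeast-≤ : ∀ {r m n} → m ≤ n → OrderAtLeast r n → OrderAtLeast r m
  orderAtLeast-≤ {r} {m} {n} m≤n (atLeast s t s∉ e) with ℕ.m≤n⇒∃[o]m+o≡n m≤n
  ... | o , refl = atLeast s (t * π ^ o) s∉ (begin
    s * r                    ≈⟨ e ⟩
    t * π ^ (m ℕ.+ o)        ≈⟨ *-congˡ (^-homo-* π m o) ⟩
    t * (π ^ m * π ^ o)      ≈⟨ Id.x∙yz≈xz∙y t (π ^ m) (π ^ o) ⟩
    (t * π ^ o) * π ^ m      ∎)

  -- Otherwise the power of π could be cancelled, leaving a product of elements
  -- outside M on one side and a multiple of π on the other.
  orderAtLeast⇒≤ : ∀ {r m n} → OrderAtLeast r m → HasOrder r n → m ≤ n
  orderAtLeast⇒≤ {r} {m} {n} (atLeast s t s∉ e) (exactly s′ t′ s′∉ t′∉ e′) with m ℕ.≤? n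
  ... | yes m≤n = m≤n
  ... | no m≰n with ℕ.m≤n⇒∃[o]m+o≡n (ℕ.≰⇒> m≰n)
  ...   | o , refl = contradiction
    (Ideal.resp M (≈-sym (*-cancelˡ isDomain (^-nonzero isDomain π≉0 n) (begin
      π ^ n * (s * t′)                       ≈⟨ Id.x∙yz≈z∙xy s t′ (π ^ n) ⟨
      s * (t′ * π ^ n)                       ≈⟨ *-congˡ e′ ⟨
      s * (s′ * r)                           ≈⟨ Id.x∙yz≈y∙xz s s′ r ⟩
      s′ * (s * r)                           ≈⟨ *-congˡ e ⟩
      s′ * (t * π ^ (suc n ℕ.+ o))           ≈⟨ *-congˡ (*-congˡ (^-homo-* π (suc n) o)) ⟩
      s′ * (t * ((π * π ^ n) * π ^ o))       ≈⟨ Id.x[y∙zwv]≈w∙xyvz s′ t π (π ^ n) (π ^ o) ⟩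
      π ^ n * ((s′ * t * π ^ o) * π)         ∎)))
      (Ideal.*-closed M _ π∈M))
    (∉-* s∉ t′∉)

  hasOrder-unique : ∀ {r m n} → HasOrder r m → HasOrder r n → m ≡ n
  hasOrder-unique p q = ℕ.≤-antisym (orderAtLeast⇒≤ (hasOrder⇒orderAtLeast p) q) (orderAtLeast⇒≤ (hasOrder⇒orderAtLeast q) p)

  -- The equation would give `t * π ^ n ≈ 0#`, although `t`, being outside `M`, and `π` are both
  -- nonzero.
  ¬hasOrder-0 : ∀ {r n} → r ≈ 0# → ¬ HasOrder r n
  ¬hasOrder-0 {r} {n} r≈0 (exactly s t s∉ t∉ e) =
    [ (λ t≈0 → t∉ (Ideal.resp M (≈-sym t≈0) (Ideal.0#-mem M)))
    , ^-nonzero isDomain π≉0 n ]′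
    (IsDomain.noZeroDivisor isDomain
      (≈-trans (≈-sym e) (≈-trans (*-congˡ r≈0) (zeroʳ s))))

  -- The ideal quotient of `⟨ q ⟩` by `s`. Since it is an ideal, `⊛-⊆` reduces divisibility on a
  -- product of ideals to products of two elements.
  colon : Carrier → Carrier → Ideal R
  colon s q = record
    { Member   = λ x → s * x ∈ ⟨ q ⟩
    ; resp     = λ e → Ideal.resp ⟨ q ⟩ (*-congˡ e)
    ; 0#-mem   = Ideal.resp ⟨ q ⟩ (≈-sym (zeroʳ s)) (Ideal.0#-mem ⟨ q ⟩)
    ; +-closed = λ x∈ y∈ → Ideal.resp ⟨ q ⟩ (≈-sym (distribˡ s _ _))
        (Ideal.+-closed ⟨ q ⟩ x∈ y∈)
    ; *-closed = λ r {x} x∈ → Ideal.resp ⟨ q ⟩ (Id.x∙yz≈y∙xz r s x)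
        (Ideal.*-closed ⟨ q ⟩ r x∈)
    }

  -- Reading the order off a factorisation into maximal ideals.

  module _ (≐M? : (P : Ideal R) → Dec (P ≐ M)) where

    count : List (Ideal R) → ℕ
    count Ps = length (filter ≐M? Ps)

    -- Each factor equal to `M` contributes one `u` and one `π` through `divides`; the other factors
    -- only multiply by ring elements, which the ideal absorbs.
    ∏-divisible : ∀ Ps → ∏ Ps ⊆ colon (u ^ count Ps) (π ^ count Ps)
    ∏-divisible [] {x} _ = x , *-comm 1# x
    ∏-divisible (P ∷ Ps) with ≐M? P
    ... | yes P≐M =
      ⊛-⊆ {I = P} {J = ∏ Ps} (colon _ _) λ {x} {y} x∈ y∈ →
        let a , p = divides (proj₁ P≐M x∈)
            b , q = ∏-divisible Ps y∈
        in a * b , (begin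
          (u * u ^ count Ps) * (x * y)       ≈⟨ Id.xy∙zw≈xz∙yw _ _ _ _ ⟩
          (u * x) * (u ^ count Ps * y)       ≈⟨ *-cong p q ⟩
          (a * π) * (b * π ^ count Ps)       ≈⟨ Id.xy∙zw≈xz∙yw _ _ _ _ ⟩
          (a * b) * (π * π ^ count Ps)       ∎)
    ... | no P≭M =
      ⊛-⊆ {I = P} {J = ∏ Ps} (colon _ _) λ {x} {y} _ y∈ →
        Ideal.*-closed (colon _ _) x (∏-divisible Ps y∈)

    module _ (∉-stable : ∀ {P : Ideal R} → ¬ (P ⊆ M) → ∃ λ x → x ∈ P × x ∉ M) where

      -- Take `π` from every factor equal to `M` and an element outside `M` from every other one;
      -- `v` collects the latter and stays outside `M` because `M` is prime.
      ∏-contains : ∀ Ps → All IsMaximal Ps → ∃ λ v → v ∉ M × v * π ^ count Ps ∈ ∏ Ps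
      ∏-contains [] [] = 1# , proper , (_ , ≈-sym (*-identityʳ _))
      ∏-contains (P ∷ Ps) (max ∷ maxs) with ≐M? P | ∏-contains Ps maxs
      ... | yes P≐M | v , v∉ , vπ∈ =
        v , v∉ , Ideal.resp (P ⊛ ∏ Ps) (Id.x∙yz≈y∙xz π v (π ^ count Ps))
          (⊛-mem {I = P} {J = ∏ Ps} (proj₂ P≐M π∈M) vπ∈)
      ... | no P≭M | v , v∉ , vπ∈ =
        -- A maximal ideal contained in the proper ideal `M` equals it, so a factor different from
        -- `M` has an element outside.
        let p , p∈ , p∉ = ∉-stable {P} λ P⊆M →
              P≭M (P⊆M , IsMaximal.maximal max M P⊆M proper)
        in p * v , ∉-* p∉ v∉ , Ideal.resp (P ⊛ ∏ Ps) (≈-sym (*-assoc p v (π ^ count Ps)))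
             (⊛-mem {I = P} {J = ∏ Ps} p∈ vπ∈)

      -- `∏-divisible` gives `s * r ≈ t * π ^ n`, and `∏-contains` gives `v * π ^ n ≈ a * r`.
      -- Cancelling `π ^ n` leaves `s * v ≈ a * t`; as `s * v` is outside `M`, so is `t`.
      hasOrder-count : ∀ {r} Ps → All IsMaximal Ps → principal r ≐ ∏ Ps → HasOrder r (count Ps)
      hasOrder-count {r} Ps maxs (r⊆ , ⊆r) =
        let n = count Ps
            t , p = ∏-divisible Ps (r⊆ (1# , ≈-sym (*-identityˡ r)))
            v , v∉ , vπ∈ = ∏-contains Ps maxs
            a , q = ⊆r vπ∈
            s = u ^ n
            s∉ = ∉-^ u∉M n
            sv≈at = *-cancelˡ isDomain {π ^ n} {s * v} {a * t} (^-nonzero isDomain π≉0 n) (begin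
              π ^ n * (s * v)      ≈⟨ Id.x∙yz≈z∙xy s v (π ^ n) ⟨
              s * (v * π ^ n)      ≈⟨ *-congˡ q ⟩
              s * (a * r)          ≈⟨ Id.x∙yz≈y∙xz s a r ⟩
              a * (s * r)          ≈⟨ *-congˡ p ⟩
              a * (t * π ^ n)      ≈⟨ Id.x∙yz≈z∙xy a t (π ^ n) ⟩
              π ^ n * (a * t)      ∎)
        in exactly s t s∉
             (λ t∈ → ∉-* s∉ v∉ (Ideal.resp M (≈-sym sv≈at) (Ideal.*-closed M a t∈))) p

-- Existence of a uniformiser.

module _ {c ℓ} {R : CommutativeRing c ℓ} (isDomain : IsDomain R)
         {M : Ideal R} (M! : IsPrime M) (∈M? : ∀ x → Dec (x ∈ M)) where

  open CommutativeRing R renaming (refl to ≈-refl; sym to ≈-sym; trans to ≈-trans)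
  open SetoidReasoning setoid
  private
    module Id = ProductIdentities commutativeSemiring

    ⟨_⟩ : Carrier → Ideal R
    ⟨_⟩ = principal

    ∉⇒≉0 : ∀ {x} → x ∉ M → ¬ x ≈ 0#
    ∉⇒≉0 x∉ x≈0 = x∉ (Ideal.resp M (≈-sym x≈0) (Ideal.0#-mem M))

  -- Every product in the sum for `w` is a multiple of `z`, and these coefficients add up to `a`, so
  -- they cannot all lie in `M`. The use needs only `a = 1#`, but the induction on the sum needs any
  -- `a ∉ M`.
  ∃-product∉ : ∀ {J z} → ¬ z ≈ 0# → M ⊛ J ⊆ ⟨ z ⟩ → ∀ {a w} → a ∉ M → w ∈ M ⊛ J → w ≈ a * z →
    ∃₂ λ x y → ∃ λ u → x ∈ M × y ∈ J × u ∉ M × x * y ≈ u * z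
  ∃-product∉ z≉0 MJ⊆z a∉ (nil w≈0) w≈az =
    contradiction (≈-trans (≈-sym w≈az) w≈0) (*-nonzero isDomain (∉⇒≉0 a∉) z≉0)
  ∃-product∉ {J} {z} z≉0 MJ⊆z {a} {w} a∉ (cons {x} {y} {w′} x∈ y∈ w′∈ w≈xy+w′) w≈az
    with MJ⊆z (⊛-mem {I = M} {J = J} x∈ y∈) | MJ⊆z w′∈
  ... | u , xy≈uz | b , w′≈bz with ∈M? u
  ...   | no u∉  = x , y , u , x∈ , y∈ , u∉ , xy≈uz
  -- The first coefficient lies in `M` and `a ≈ u + b`, so the coefficient `b` of the remaining sum
  -- is still outside `M`.
  ...   | yes u∈ = ∃-product∉ {J} z≉0 MJ⊆z
    (λ b∈ → a∉ (Ideal.resp M (≈-sym a≈u+b) (Ideal.+-closed M u∈ b∈))) w′∈ w′≈bz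
    where
    a≈u+b : a ≈ u + b
    a≈u+b = *-cancelˡ isDomain z≉0 (begin
      z * a              ≈⟨ *-comm z a ⟩
      a * z              ≈⟨ w≈az ⟨
      w                  ≈⟨ w≈xy+w′ ⟩
      x * y + w′         ≈⟨ +-cong xy≈uz w′≈bz ⟩
      u * z + b * z      ≈⟨ distribʳ z u b ⟨
      (u + b) * z        ≈⟨ *-comm (u + b) z ⟩
      z * (u + b)        ∎)

  -- With `x * y ≈ u * z` and `u ∉ M`, the choice is `π = x`. For `m ∈ M` the product `m * y` is
  -- some `w * z`, so `(u * m) * z` equals `m * x * y`, hence `(w * x) * z`, and `z` cancels.
  principal≐⊛⇒uniformiser : ∀ {J z} → ¬ z ≈ 0# → ⟨ z ⟩ ≐ M ⊛ J → Uniformiser M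
  principal≐⊛⇒uniformiser {J} {z} z≉0 (z⊆MJ , MJ⊆z) =
    let x , y , u , x∈ , y∈ , u∉ , xy≈uz =
          ∃-product∉ {J} z≉0 MJ⊆z (IsPrime.proper M!) (z⊆MJ (1# , ≈-refl)) ≈-refl
    in record
      { π       = x
      ; u       = u
      ; π∈M     = x∈
      ; π≉0     = λ x≈0 → *-nonzero isDomain (∉⇒≉0 u∉) z≉0
                    (≈-trans (≈-sym xy≈uz) (≈-trans (*-congʳ x≈0) (zeroˡ y)))
      ; u∉M     = u∉
      ; divides = λ {m} m∈ → let w , my≈wz = MJ⊆z (⊛-mem {I = M} {J = J} m∈ y∈) in
          w , *-cancelˡ isDomain z≉0 (begin
            z * (u * m)     ≈⟨ Id.x∙yz≈z∙xy u m z ⟨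
            u * (m * z)     ≈⟨ Id.x∙yz≈y∙xz u m z ⟩
            m * (u * z)     ≈⟨ *-congˡ xy≈uz ⟨
            m * (x * y)     ≈⟨ Id.x∙yz≈y∙xz m x y ⟩
            x * (m * y)     ≈⟨ *-congˡ my≈wz ⟩
            x * (w * z)     ≈⟨ Id.x∙yz≈z∙xy x w z ⟩
            z * (x * w)     ≈⟨ *-congˡ (*-comm x w) ⟩
            z * (w * x)     ∎)
      }

module _ {c ℓ c′ ℓ′} {R : CommutativeRing c ℓ} {K : CommutativeRing c′ ℓ′}
         {F : IsFractionField R K} (D : IsDedekindDomain F) where

  open CommutativeRing R using (1#; *-identityˡ) renaming (sym to ≈-sym)
  open Factorisation F D using (excludedMiddle; maximal⇒prime; divide)
  open IsDedekindDomain D using (isDomain)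

  ¬⊆⇒∃∉ : ∀ {I J : Ideal R} → ¬ (I ⊆ J) → ∃ λ x → x ∈ I × x ∉ J
  ¬⊆⇒∃∉ I⊈J = decidable-stable excludedMiddle λ ¬∃ → I⊈J λ {x} x∈I →
    decidable-stable excludedMiddle λ x∉J → ¬∃ (x , x∈I , x∉J)

  uniformiser : ∀ {M : Ideal R} → IsMaximal M → IsNonZero M → Uniformiser M
  uniformiser {M} max (z , z∈ , z≉0) =
    let J , _ , z≐MJ = divide {M} {principal z} max (z , (1# , ≈-sym (*-identityˡ z)) , z≉0)
          (λ (a , p) → Ideal.resp M (≈-sym p) (Ideal.*-closed M a z∈))
    in principal≐⊛⇒uniformiser isDomain {M} (maximal⇒prime {M} max)
         (λ x → excludedMiddle {x ∈ M}) {J} z≉0 z≐MJ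

-- Values of elements of the fraction field.

module FractionValue {c ℓ c′ ℓ′} {R : CommutativeRing c ℓ} {K : CommutativeRing c′ ℓ′}
                     (F : IsFractionField R K) (isDomain : IsDomain R)
                     {M : Ideal R} (M! : IsPrime M) (U : Uniformiser M) where

  private
    module R = CommutativeRing R
    module K = CommutativeRing K
    module Id = ProductIdentities K.commutativeSemiring
  open IsFractionField F
  private module ι = RingMorphisms.IsRingMonomorphism isRingMonomorphism
  open Order isDomain M! U
  open Uniformiser U using (π)
  open Exp R.semiring using (_^_)
  open SetoidReasoning K.setoid

  ι-nonzero : ∀ {r} → ¬ r R.≈ R.0# → ¬ ι r K.≈ K.0#
  ι-nonzero r≉0 p = r≉0 (ι.injective (K.trans p (K.sym ι.0#-homo)))

  -- A relation, so that any fraction representing `x` may serve. The difference is denominator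
  -- minus numerator, since elements of high order have small value.
  data HasValue (x : K.Carrier) : ℤₘ₀ → Set (c ⊔ ℓ ⊔ ℓ′) where
    zero    : x K.≈ K.0# → HasValue x 𝟎
    nonzero : ∀ {r s a b} → HasOrder r a → HasOrder s b → x K.* ι s K.≈ ι r →
              HasValue x (of-add (b ⊖ a))

  hasValue-resp : ∀ {x y v} → x K.≈ y → HasValue x v → HasValue y v
  hasValue-resp x≈y (zero x≈0)      = zero (K.trans (K.sym x≈y) x≈0)
  hasValue-resp x≈y (nonzero p q e) = nonzero p q (K.trans (K.*-congʳ (K.sym x≈y)) e)

  fraction-≈ : ∀ {x r s r′ s′} → x K.* ι s K.≈ ι r → x K.* ι s′ K.≈ ι r′ →
               r R.* s′ R.≈ r′ R.* s
  fraction-≈ {x} {r} {s} {r′} {s′} e e′ = ι.injective (begin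
    ι (r R.* s′)               ≈⟨ ι.*-homo r s′ ⟩
    ι r K.* ι s′               ≈⟨ K.*-congʳ e ⟨
    (x K.* ι s) K.* ι s′       ≈⟨ K.*-assoc x (ι s) (ι s′) ⟩
    x K.* (ι s K.* ι s′)       ≈⟨ Id.x∙yz≈xz∙y x (ι s) (ι s′) ⟩
    (x K.* ι s′) K.* ι s       ≈⟨ K.*-congʳ e′ ⟩
    ι r′ K.* ι s               ≈⟨ ι.*-homo r′ s ⟨
    ι (r′ R.* s)               ∎)

  fraction-0 : ∀ {x r s} → x K.≈ K.0# → x K.* ι s K.≈ ι r → r R.≈ R.0#
  fraction-0 {x} {r} {s} x≈0 e = ι.injective (begin
    ι r               ≈⟨ e ⟨
    x K.* ι s         ≈⟨ K.*-congʳ x≈0 ⟩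
    K.0# K.* ι s      ≈⟨ K.zeroˡ (ι s) ⟩
    K.0#              ≈⟨ ι.0#-homo ⟨
    ι R.0#            ∎)

  0-fraction : ∀ {x r s} → ¬ s R.≈ R.0# → r R.≈ R.0# → x K.* ι s K.≈ ι r → x K.≈ K.0#
  0-fraction {x} {r} {s} s≉0 r≈0 e =
    let y , ιs∙y≈1 = IsField.inverse isField (ι-nonzero s≉0)
    in begin
      x                        ≈⟨ K.*-identityʳ x ⟨
      x K.* K.1#               ≈⟨ K.*-congˡ ιs∙y≈1 ⟨
      x K.* (ι s K.* y)        ≈⟨ K.*-assoc x (ι s) y ⟨
      (x K.* ι s) K.* y        ≈⟨ K.*-congʳ e ⟩
      ι r K.* y                ≈⟨ K.*-congʳ (K.trans (ι.⟦⟧-cong r≈0) ι.0#-homo) ⟩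
      K.0# K.* y               ≈⟨ K.zeroˡ y ⟩
      K.0#                     ∎

  fraction-* : ∀ {x y r s r′ s′} → x K.* ι s K.≈ ι r → y K.* ι s′ K.≈ ι r′ →
               (x K.* y) K.* ι (s R.* s′) K.≈ ι (r R.* r′)
  fraction-* {x} {y} {r} {s} {r′} {s′} e e′ = begin
    (x K.* y) K.* ι (s R.* s′)            ≈⟨ K.*-congˡ (ι.*-homo s s′) ⟩
    (x K.* y) K.* (ι s K.* ι s′)          ≈⟨ Id.xy∙zw≈xz∙yw x y (ι s) (ι s′) ⟩
    (x K.* ι s) K.* (y K.* ι s′)          ≈⟨ K.*-cong e e′ ⟩
    ι r K.* ι r′                          ≈⟨ ι.*-homo r r′ ⟨
    ι (r R.* r′)                          ∎

  fraction-+ : ∀ {x y r s r′ s′} → x K.* ι s K.≈ ι r → y K.* ι s′ K.≈ ι r′ →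
               (x K.+ y) K.* ι (s R.* s′) K.≈ ι (r R.* s′ R.+ r′ R.* s)
  fraction-+ {x} {y} {r} {s} {r′} {s′} e e′ = begin
    (x K.+ y) K.* ι (s R.* s′)                          ≈⟨ K.*-congˡ (ι.*-homo s s′) ⟩
    (x K.+ y) K.* (ι s K.* ι s′)                        ≈⟨ Id.sum-of-fractions x y (ι s) (ι s′) ⟩
    (x K.* ι s) K.* ι s′ K.+ (y K.* ι s′) K.* ι s       ≈⟨ K.+-cong (K.*-congʳ e) (K.*-congʳ e′) ⟩
    ι r K.* ι s′ K.+ ι r′ K.* ι s                       ≈⟨ K.+-cong (ι.*-homo r s′) (ι.*-homo r′ s) ⟨
    ι (r R.* s′) K.+ ι (r′ R.* s)                       ≈⟨ ι.+-homo _ _ ⟨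
    ι (r R.* s′ R.+ r′ R.* s)                           ∎

  -- If `r / s` and `r′ / s′` represent the same element, then `r * s′ ≈ r′ * s`, and uniqueness of
  -- orders in `R` equates the two differences. A zero fraction cannot have a numerator with an
  -- order.
  hasValue-unique : ∀ {x v w} → HasValue x v → HasValue x w → v ≡ w
  hasValue-unique (zero _)        (zero _)        = refl
  hasValue-unique (zero x≈0)      (nonzero p _ e) = contradiction p (¬hasOrder-0 (fraction-0 x≈0 e))
  hasValue-unique (nonzero p _ e) (zero x≈0)      = contradiction p (¬hasOrder-0 (fraction-0 x≈0 e))
  hasValue-unique (nonzero {a = a} {b} p q e) (nonzero {a = a′} {b′} p′ q′ e′) =
    cong (λ n → of-add n) (⊖-cross-≡ b a b′ a′ (trans (ℕ.+-comm b a′)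
      (trans (hasOrder-unique (hasOrder-resp (R.sym (fraction-≈ e e′)) (hasOrder-* p′ q))
                              (hasOrder-* p q′))
             (ℕ.+-comm a b′))))

  hasValue-1 : HasValue K.1# 𝟏
  hasValue-1 = nonzero hasOrder-1 hasOrder-1 (K.*-identityˡ _)

  hasValue-* : ∀ {x y v w} → HasValue x v → HasValue y w → HasValue (x K.* y) (v · w)
  hasValue-* {y = y} (zero x≈0) _ = zero (K.trans (K.*-congʳ x≈0) (K.zeroˡ y))
  hasValue-* {x} (nonzero _ _ _) (zero y≈0) = zero (K.trans (K.*-congˡ y≈0) (K.zeroʳ x))
  hasValue-* {x} {y} (nonzero {a = a} {b} p q e) (nonzero {a = a′} {b′} p′ q′ e′) =
    subst (λ n → HasValue (x K.* y) (of-add n)) (sym (⊖-+-⊖ b a b′ a′))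
      (nonzero (hasOrder-* p p′) (hasOrder-* q q′) (fraction-* e e′))

  -- The value `u` of the sum is a hypothesis because the orders of the summands bound the order of
  -- the sum only from below.
  hasValue-+ : ∀ {x y v w u} → HasValue x v → HasValue y w → HasValue (x K.+ y) u →
               u ≤ₘ₀ v ⊎ u ≤ₘ₀ w
  hasValue-+ p q (zero _) = inj₁ (⊥₋≤ _)
  hasValue-+ {y = y} (zero x≈0) q t@(nonzero _ _ _) = inj₂ (TotalOrder.reflexive ℤₘ₀-totalOrder
    (hasValue-unique (hasValue-resp (K.trans (K.+-congʳ x≈0) (K.+-identityˡ y)) t) q))
  hasValue-+ {x} p@(nonzero _ _ _) (zero y≈0) t@(nonzero _ _ _) = inj₁ (TotalOrder.reflexive ℤₘ₀-totalOrder
    (hasValue-unique (hasValue-resp (K.trans (K.+-congˡ y≈0) (K.+-identityʳ x)) t) p))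
  -- Over the common denominator `s * s′` the numerators have orders `a + b′` and `a′ + b`; the
  -- summand attaining the minimum is the one whose value bounds `u`.
  hasValue-+ (nonzero {r} {s} {a} {b} p q e) (nonzero {r′} {s′} {a′} {b′} p′ q′ e′)
             (nonzero {r″} {s″} {a″} {b″} p″ q″ e″)
    = [ (λ min≡n → inj₁ [ ⊖-cross-≤ b″ a″ b a (+-cancel-≤ a b b′ a″ b″
          (subst₂ (λ k l → k ℕ.+ b″ ≤ a″ ℕ.+ l) min≡n refl bound)) ])
      , (λ min≡m → inj₂ [ ⊖-cross-≤ b″ a″ b′ a′ (+-cancel-≤ a′ b′ b a″ b″
          (subst₂ (λ k l → k ℕ.+ b″ ≤ a″ ℕ.+ l) min≡m (ℕ.+-comm b b′) bound)) ])
      ]′ (ℕ.⊓-sel (a ℕ.+ b′) (a′ ℕ.+ b))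
    where
    bound : ((a ℕ.+ b′) ℕ.⊓ (a′ ℕ.+ b)) ℕ.+ b″ ≤ a″ ℕ.+ (b ℕ.+ b′)
    -- Cross-multiplying `r″ / s″` with the computed sum makes both sides describe one element: a
    -- lower bound for its order from the sum, its exact order from `r″ * (s * s′)`.
    bound = orderAtLeast⇒≤
      (orderAtLeast-* (orderAtLeast-+
        (orderAtLeast-≤ (ℕ.m⊓n≤m _ _) (hasOrder⇒orderAtLeast (hasOrder-* p q′)))
        (orderAtLeast-≤ (ℕ.m⊓n≤n (a ℕ.+ b′) _) (hasOrder⇒orderAtLeast (hasOrder-* p′ q))))
        (hasOrder⇒orderAtLeast q″))
      (hasOrder-resp (fraction-≈ e″ (fraction-+ e e′)) (hasOrder-* p″ (hasOrder-* q q′)))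

  -- As `π` has value `of-add (-1)`, nonnegative exponents come from inverses of powers of `π`,
  -- negative ones from the powers themselves.
  ∃-hasValue : ∀ v → ∃ λ x → HasValue x v
  ∃-hasValue 𝟎                 = K.0# , zero K.refl
  ∃-hasValue (of-add (+ n))    =
    let y , e = IsField.inverse isField (ι-nonzero (^-nonzero isDomain (Uniformiser.π≉0 U) n))
    in y , nonzero hasOrder-1 (hasOrder-π^ n)
             (K.trans (K.*-comm y _) (K.trans e (K.sym ι.1#-homo)))
  ∃-hasValue (of-add -[1+ n ]) = ι (π ^ suc n) , nonzero (hasOrder-π^ (suc n)) hasOrder-1
    (K.trans (K.*-congˡ ι.1#-homo) (K.*-identityʳ _))

-- The adic valuation and its discreteness.

module _ {c ℓ c′ ℓ′} {R : CommutativeRing c ℓ} {K : CommutativeRing c′ ℓ′}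
         {F : IsFractionField R K} (D : IsDedekindDomain F)
         {M : Ideal R} (M! : IsPrime M) (U : Uniformiser M) where

  private
    module R = CommutativeRing R
    module K = CommutativeRing K
  open IsFractionField F using (fraction)
  open Factorisation F D using (excludedMiddle; _≈?_; maximalFactorisation)
  open IsDedekindDomain D using (isDomain)
  open Order isDomain M! U
  open FractionValue F isDomain M! U

  hasOrder-exponent : ∀ r (r≉0 : ¬ r R.≈ R.0#) → HasOrder r (exponent D M r r≉0)
  hasOrder-exponent r r≉0 = hasOrder-count (λ P → excludedMiddle {P ≐ M})
    (λ {P} → ¬⊆⇒∃∉ D {P} {M}) factors maximal product-≐
    where
    open MaximalFactorisation
      (maximalFactorisation (principal r) (r , (R.1# , R.sym (R.*-identityˡ r)) , r≉0))

  hasValue-adicValuation : ∀ x → HasValue x (adicValuation D M x)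
  hasValue-adicValuation x with fraction x
  ... | r , s , s≉0 , e with r ≈? R.0#
  ...   | yes r≈0 = zero (0-fraction s≉0 r≈0 e)
  ...   | no r≉0  = subst (λ n → HasValue x (of-add n))
    -- Rewrites `b ⊖ a` as the negated difference of exponents in `adicValuation`.
    (trans (ℤ.⊖-swap b a) (cong ℤ.-_ (sym (ℤ.m-n≡m⊖n a b))))
    (nonzero (hasOrder-exponent r r≉0) (hasOrder-exponent s s≉0) e)
    where
    a = exponent D M r r≉0
    b = exponent D M s s≉0

  -- Each equation holds because both sides are values of the same element, and `HasValue` is
  -- single-valued.
  adicValuation-isDiscrete : IsDiscreteValuation K (adicValuation D M)
  adicValuation-isDiscrete = record
    { isValuation = record
      { cong    = λ {x} {y} x≈y → hasValue-unique (hasValue-resp x≈y (value x)) (value y)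
      ; 0#-homo = hasValue-unique (value K.0#) (zero K.refl)
      ; 1#-homo = hasValue-unique (value K.1#) hasValue-1
      ; *-homo  = λ x y → hasValue-unique (value (x K.* y)) (hasValue-* (value x) (value y))
      ; +-ultra = λ x y → ≤-max (hasValue-+ (value x) (value y) (value (x K.+ y)))
      }
    ; surjective  = λ v → let x , p = ∃-hasValue v in
        x , λ {y} y≈x → hasValue-unique (value y) (hasValue-resp (K.sym y≈x) p)
    }
    where value = hasValue-adicValuation

mainTheorem3 : ∀ {c ℓ c′ ℓ′ : Level}
    {R : CommutativeRing c ℓ} {K : CommutativeRing c′ ℓ′}
    {F : IsFractionField R K} (D : IsDedekindDomain F)
    (M : Ideal R) → IsPrime M → IsNonZero M →
    IsDiscreteValuation K (adicValuation D M)
mainTheorem3 D M M! M≠0 = adicValuation-isDiscrete D M!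
  -- Dimension at most one makes the nonzero prime `M` maximal, as `divide` requires.
  (uniformiser D {M} (IsDedekindDomain.dimension≤1 D M M! M≠0) M≠0)
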